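{- Let $\mathsf a=(\mathsf a_{\ell,\ell'})_{\ell,\ell'\ge0}$, $\mathsf b,\mathsf c,\mathsf d$ (likewise doubly indexed), $\mathsf e=(\mathsf e_\ell)_{\ell\ge0}$, $\mathsf f=(\mathsf f_\ell)_{\ell\ge0}$ be indeterminates. For $n\ge0$ define $$Q'_n=\sum_{\sigma\in\mathfrak D_{2n}}\prod_{i\in\mathrm{Cval}(\sigma)}\mathsf a_{\mathrm{lcross}'(i,\sigma),\mathrm{lnest}'(i,\sigma)}\prod_{i\in\mathrm{Cpeak}(\sigma)}\mathsf b_{\mathrm{ucross}'(i,\sigma),\mathrm{unest}'(i,\sigma)}\prod_{i\in\mathrm{Cdfall}(\sigma)}\mathsf c_{\mathrm{lcross}'(i,\sigma),\mathrm{lnest}'(i,\sigma)}\prod_{i\in\mathrm{Cdrise}(\sigma)}\mathsf d_{\mathrm{ucross}'(i,\sigma),\mathrm{unest}'(i,\sigma)}\prod_{i\in\mathrm{Evenfix}(\sigma)}\mathsf e_{\mathrm{psnest}(i,\sigma)}\prod_{i\in\mathrm{Oddfix}(\sigma)}\mathsf f_{\mathrm{psnest}(i,\sigma)},$$ and let $Q_n$ be defined by the same formula but with the factors $\mathsf a_{\mathrm{ucross}(i,\sigma),\mathrm{unest}(i,\sigma)}$, $\mathsf b_{\mathrm{lcross}(i,\sigma),\mathrm{lnest}(i,\sigma)}$, $\mathsf c_{\mathrm{lcross}(i,\sigma),\mathrm{lnest}(i,\sigma)}$, $\mathsf d_{\mathrm{ucross}(i,\sigma),\mathrm{unest}(i,\sigma)}$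 for cycle valleys, cycle peaks, cycle double falls, cycle double rises respectively. Then $\sum_{n\ge0}Q'_nt^n$ equals the T-type continued fraction with coefficients $\alpha_{2k-1}=\bigl(\sum_{\xi=0}^{k-1}\mathsf a_{k-1-\xi,\xi}\bigr)\bigl(\sum_{\xi=0}^{k-1}\mathsf b_{k-1-\xi,\xi}\bigr)$, $\alpha_{2k}=\bigl(\mathsf e_k+\sum_{\xi=0}^{k-1}\mathsf c_{k-1-\xi,\xi}\bigr)\bigl(\mathsf f_k+\sum_{\xi=0}^{k-1}\mathsf d_{k-1-\xi,\xi}\bigr)$ ($k\ge1$), $\delta_1=\mathsf e_0\mathsf f_0$, $\delta_n=0$ ($n\ge2$); consequently $Q_n=Q'_n$ for all $n\ge0$.
   Context: $\mathfrak D_{2n}$ is the set of permutations $\sigma$ of $[2n]$ with $\sigma(2k-1)\ge2k-1$ and $\sigma(2k)\le2k$ for all $k\in[n]$. $\mathrm{Cval}(\sigma)=\{i:\sigma^{ -1}(i)>i<\sigma(i)\}$, $\mathrm{Cpeak}(\sigma)=\{i:\sigma^{ -1}(i)<i>\sigma(i)\}$, $\mathrm{Cdrise}(\sigma)=\{i:\sigma^{ -1}(i)<i<\sigma(i)\}$, $\mathrm{Cdfall}(\sigma)=\{i:\sigma^{ -1}(i)>i>\sigma(i)\}$; $\mathrm{Evenfix}(\sigma),\mathrm{Oddfix}(\sigma)$ are the sets of even/odd fixed points. Statistics: $\mathrm{ucross}(j,\sigma)=\#\{i<j<k<l:k=\sigma(i),l=\sigma(j)\}$, $\mathrm{unest}(j,\sigma)=\#\{i<j<k<l:k=\sigma(j),l=\sigma(i)\}$,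 $\mathrm{lcross}(k,\sigma)=\#\{i<j<k<l:i=\sigma(k),j=\sigma(l)\}$, $\mathrm{lnest}(k,\sigma)=\#\{i<j<k<l:i=\sigma(l),j=\sigma(k)\}$ (counting the remaining three indices); variants: $\mathrm{ucross}'(k,\sigma)=\#\{(i,j,l):i<j<k<l,\ k=\sigma(i),\ l=\sigma(j)\}$, $\mathrm{unest}'(k,\sigma)=\#\{(i,j,l):i<j<k<l,\ k=\sigma(j),\ l=\sigma(i)\}$, $\mathrm{lcross}'(j,\sigma)=\#\{(i,k,l):i<j<k<l,\ i=\sigma(k),\ j=\sigma(l)\}$, $\mathrm{lnest}'(j,\sigma)=\#\{(i,k,l):i<j<k<l,\ i=\sigma(l),\ j=\sigma(k)\}$; for a fixed point $j$, $\mathrm{psnest}(j,\sigma)=\#\{i<j:\sigma(i)>j\}$. The T-type continued fraction with coefficients $(\alpha_n),(\delta_n)$ is $1/(1-\delta_1t-\alpha_1t/(1-\delta_2t-\alpha_2t/(1-\delta_3t-\cdots)))$. -}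

module Defs where

open import Level using (Level)
open import Data.Nat as ℕ using (ℕ; zero; suc; _∸_; _<ᵇ_; _≡ᵇ_; ⌊_/2⌋; ⌈_/2⌉)
open import Data.Bool using (Bool; true; false; _∧_; not; if_then_else_)
open import Data.List using (List; []; _∷_; map; concatMap; length; foldr; upTo)
open import Data.Product using (_×_; _,_; proj₁; proj₂)
open import Algebra.Bundles using (CommutativeSemiring)

range : ℕ → List ℕ
range N = map suc (upTo N)

boolFilter : {A : Set} → (A → Bool) → List A → List A
boolFilter p [] = []
boolFilter p (x ∷ xs) = if p x then x ∷ boolFilter p xs else boolFilter p xs

countB : {A : Set} → (A → Bool) → List A → ℕ
countB p xs = length (boolFilter p xs)

allB : {A : Set} → (A → Bool) → List A → Bool
allB p [] = true
allB p (x ∷ xs) = p x ∧ allB p xs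

-- A map σ : [N] → [N] is stored as the list (σ(1), …, σ(N)).
-- app σ i = σ(i) for 1 ≤ i ≤ N (1-based indexing).
nth : List ℕ → ℕ → ℕ
nth [] _ = 0
nth (x ∷ xs) zero = x
nth (x ∷ xs) (suc i) = nth xs i

app : List ℕ → ℕ → ℕ
app σ i = nth σ (i ∸ 1)

words : ℕ → ℕ → List (List ℕ)
words zero k = [] ∷ []
words (suc m) k = concatMap (λ x → map (x ∷_) (words m k)) (range k)

-- σ (a word of length N over [N]) is a permutation iff it is injective
isPerm : ℕ → List ℕ → Bool
isPerm N σ = allB (λ i → allB (λ j → if app σ i ≡ᵇ app σ j then i ≡ᵇ j else true) (range N)) (range N)

_≤ᵇ'_ : ℕ → ℕ → Bool
m ≤ᵇ' n = m <ᵇ suc n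

isD : ℕ → List ℕ → Bool
isD n σ = allB (λ k → ((2 ℕ.* k ∸ 1) ≤ᵇ' app σ (2 ℕ.* k ∸ 1)) ∧ (app σ (2 ℕ.* k) ≤ᵇ' (2 ℕ.* k))) (range n)

D : ℕ → List (List ℕ)
D n = boolFilter (λ σ → isPerm (2 ℕ.* n) σ ∧ isD n σ) (words (2 ℕ.* n) (2 ℕ.* n))

-- σ⁻¹(i) (first preimage in [N]; exact for permutations)
findFirst : (ℕ → Bool) → List ℕ → ℕ
findFirst p [] = 0
findFirst p (x ∷ xs) = if p x then x else findFirst p xs

inv : ℕ → List ℕ → ℕ → ℕ
inv N σ i = findFirst (λ p → app σ p ≡ᵇ i) (range N)

triples : ℕ → List (ℕ × ℕ × ℕ)
triples N = concatMap (λ x → concatMap (λ y → map (λ z → (x , y , z)) (range N)) (range N)) (range N)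

lt4 : ℕ → ℕ → ℕ → ℕ → Bool
lt4 i j k l = (i <ᵇ j) ∧ (j <ᵇ k) ∧ (k <ᵇ l)

ucross : ℕ → List ℕ → ℕ → ℕ
ucross N σ j = countB (λ { (i , k , l) → lt4 i j k l ∧ (k ≡ᵇ app σ i) ∧ (l ≡ᵇ app σ j) }) (triples N)

unest : ℕ → List ℕ → ℕ → ℕ
unest N σ j = countB (λ { (i , k , l) → lt4 i j k l ∧ (k ≡ᵇ app σ j) ∧ (l ≡ᵇ app σ i) }) (triples N)

lcross : ℕ → List ℕ → ℕ → ℕ
lcross N σ k = countB (λ { (i , j , l) → lt4 i j k l ∧ (i ≡ᵇ app σ k) ∧ (j ≡ᵇ app σ l) }) (triples N)

lnest : ℕ → List ℕ → ℕ → ℕ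
lnest N σ k = countB (λ { (i , j , l) → lt4 i j k l ∧ (i ≡ᵇ app σ l) ∧ (j ≡ᵇ app σ k) }) (triples N)

ucross' : ℕ → List ℕ → ℕ → ℕ
ucross' N σ k = countB (λ { (i , j , l) → lt4 i j k l ∧ (k ≡ᵇ app σ i) ∧ (l ≡ᵇ app σ j) }) (triples N)

unest' : ℕ → List ℕ → ℕ → ℕ
unest' N σ k = countB (λ { (i , j , l) → lt4 i j k l ∧ (k ≡ᵇ app σ j) ∧ (l ≡ᵇ app σ i) }) (triples N)

lcross' : ℕ → List ℕ → ℕ → ℕ
lcross' N σ j = countB (λ { (i , k , l) → lt4 i j k l ∧ (i ≡ᵇ app σ k) ∧ (j ≡ᵇ app σ l) }) (triples N)

lnest' : ℕ → List ℕ → ℕ → ℕ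
lnest' N σ j = countB (λ { (i , k , l) → lt4 i j k l ∧ (i ≡ᵇ app σ l) ∧ (j ≡ᵇ app σ k) }) (triples N)

psnest : ℕ → List ℕ → ℕ → ℕ
psnest N σ j = countB (λ i → (i <ᵇ j) ∧ (j <ᵇ app σ i)) (range N)

isCval isCpeak isCdrise isCdfall isEvenfix isOddfix : ℕ → List ℕ → ℕ → Bool
isCval   N σ i = (i <ᵇ inv N σ i) ∧ (i <ᵇ app σ i)
isCpeak  N σ i = (inv N σ i <ᵇ i) ∧ (app σ i <ᵇ i)
isCdrise N σ i = (inv N σ i <ᵇ i) ∧ (i <ᵇ app σ i)
isCdfall N σ i = (i <ᵇ inv N σ i) ∧ (app σ i <ᵇ i)

isEven : ℕ → Bool
isEven zero = true
isEven (suc n) = not (isEven n)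

isEvenfix N σ i = (app σ i ≡ᵇ i) ∧ isEven i
isOddfix  N σ i = (app σ i ≡ᵇ i) ∧ not (isEven i)

Stat : Set
Stat = ℕ → List ℕ → ℕ → ℕ

-- Weights in an arbitrary commutative semiring (the indeterminates are
-- arbitrary elements; polynomial identities ⇔ identities for all such).

module _ {c ℓ : Level} (R : CommutativeSemiring c ℓ) where
  open CommutativeSemiring R

  sumOver : {A : Set} → List A → (A → Carrier) → Carrier
  sumOver xs g = foldr (λ x r → g x + r) 0# xs

  prodOver : {A : Set} → List A → (A → Carrier) → Carrier
  prodOver xs g = foldr (λ x r → g x * r) 1# xs

  weightGen : (a b c' d : ℕ → ℕ → Carrier) (e f : ℕ → Carrier)
              (sv₁ sv₂ sp₁ sp₂ sf₁ sf₂ sr₁ sr₂ : Stat) → ℕ → List ℕ → Carrier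
  weightGen a b c' d e f sv₁ sv₂ sp₁ sp₂ sf₁ sf₂ sr₁ sr₂ N σ =
    prodOver (range N) (λ i →
      if isCval N σ i then a (sv₁ N σ i) (sv₂ N σ i) else
      if isCpeak N σ i then b (sp₁ N σ i) (sp₂ N σ i) else
      if isCdfall N σ i then c' (sf₁ N σ i) (sf₂ N σ i) else
      if isCdrise N σ i then d (sr₁ N σ i) (sr₂ N σ i) else
      if isEvenfix N σ i then e (psnest N σ i) else
      if isOddfix N σ i then f (psnest N σ i) else 1#)

  Q' : (a b c' d : ℕ → ℕ → Carrier) (e f : ℕ → Carrier) → ℕ → Carrier
  Q' a b c' d e f n = sumOver (D n) (weightGen a b c' d e f
    lcross' lnest' ucross' unest' lcross' lnest' ucross' unest' (2 ℕ.* n))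

  Q : (a b c' d : ℕ → ℕ → Carrier) (e f : ℕ → Carrier) → ℕ → Carrier
  Q a b c' d e f n = sumOver (D n) (weightGen a b c' d e f
    ucross unest lcross lnest lcross lnest ucross unest (2 ℕ.* n))

  diagSum : (ℕ → ℕ → Carrier) → ℕ → Carrier
  diagSum x k = sumOver (upTo k) (λ ξ → x (k ∸ 1 ∸ ξ) ξ)

  -- α_j (j ≥ 1; α_0 unused): α_{2k-1}, α_{2k} as in the theorem
  αQ : (a b c' d : ℕ → ℕ → Carrier) (e f : ℕ → Carrier) → ℕ → Carrier
  αQ a b c' d e f j =
    if isEven j
    then (e ⌊ j /2⌋ + diagSum c' ⌊ j /2⌋) * (f ⌊ j /2⌋ + diagSum d ⌊ j /2⌋)
    else (diagSum a ⌈ j /2⌉ * diagSum b ⌈ j /2⌉)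

  -- δ_1 = e_0 f_0, δ_n = 0 for n ≥ 2 (δ_0 unused)
  δQ : (e f : ℕ → Carrier) → ℕ → Carrier
  δQ e f (suc zero) = e 0 * f 0
  δQ e f _ = 0#

  -- Formal power series of the T-fraction.  Level j of the fraction is
  --   T_j = 1/(1 - δ_j t - α_j t T_{j+1}),  i.e.  T_j = 1 + t (δ_j + α_j T_{j+1}) T_j,
  -- and the T-fraction is T_1.  Coefficients are computed by the iteration
  --   iter (n+1) j = 1 + t (δ_j + α_j · iter n (j+1)) · iter n j,
  -- whose coefficient of t^m is exact (equal to [t^m] T_j) as soon as n ≥ m.
  iter : (α δ : ℕ → Carrier) → ℕ → ℕ → ℕ → Carrier
  iter α δ zero j zero = 1#
  iter α δ zero j (suc m) = 0#
  iter α δ (suc n) j zero = 1#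
  iter α δ (suc n) j (suc m) =
    sumOver (upTo (suc m)) (λ k →
      ((if k ≡ᵇ 0 then δ j else 0#) + α j * iter α δ n (suc j) k) * iter α δ n j (m ∸ k))

  TFrac : (α δ : ℕ → Carrier) → ℕ → Carrier
  TFrac α δ m = iter α δ m 1 m

-- A permutation σ of [N] is built in N steps.  After step i one knows σ(1), …, σ(i), where values
-- above i are left open, and the relative order of the positions beyond i of the values up to i.
-- The number h of open values equals the number of values still to be placed.  Step k closes
-- position k (it takes the first waiting value, or stays open) and then the value k (it fills
-- one of the open positions, or is inserted anywhere among the waiting values).  The numbers of
-- open positions, or of waiting values, on either side of the chosen place are the primed crossing
-- and nesting numbers of k, so that each step contributes a diagonal sum depending only on h:
-- the sum over σ is a sum over weighted Motzkin paths.  Two consecutive steps make one power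
-- of t, and a first-passage recurrence for the products T₁ T₂ ⋯ T_j of the tails of the T-fraction
-- shows that it generates these paths.
-- For the unprimed statistics one passes to σ⁻¹, which turns (ucross, unest) into (lcross', lnest')
-- and (lcross, lnest) into (ucross', unest').  Cycle valleys and peaks are preserved while cycle
-- double rises and double falls are exchanged, and the step weights come out the same.

module Submission where

open import Defs
open import Level using (Level; _⊔_)
open import Data.Nat.Base as ℕ using (ℕ; zero; suc; _∸_; _≤_; _<_; z≤n; s≤s; s≤s⁻¹; _≡ᵇ_; _<ᵇ_; ⌊_/2⌋)
open import Data.Nat.Properties as ℕ
  using (≤-refl; <⇒≤; +-suc; *-suc; m∸n≤m; m≤n+m; n∸n≡0; m∸n+n≡m; ∸-+-assoc; +-∸-assoc)
open import Data.Bool.Base using (Bool; true; false; if_then_else_; not; _∧_)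
open import Data.List.Base using (List; []; _∷_; _++_; map; concatMap; length; upTo; applyUpTo; take; drop)
open import Data.List.Properties using (length-++; length-map; length-upTo; ++-assoc; ++-identityʳ;
  map-++; map-∘; map-upTo; map-cong-local; map-id-local; upTo-∷ʳ; ∷-injective; ∷ʳ-injective)
open import Data.List.Membership.Propositional using (_∈_; find; lose)
open import Data.List.Membership.Propositional.Properties
  using (∈-upTo⁻; ∈-upTo⁺; ∈-map⁺; ∈-map⁻; ∈-concatMap⁺; ∈-concatMap⁻; ∈-++⁺ˡ; ∈-++⁺ʳ; ∈-++⁻)
open import Data.List.Membership.Propositional.Properties.WithK using (unique∧set⇒bag)
open import Data.List.Relation.Unary.Any using (here; there)
open import Data.List.Relation.Unary.All as All using (All; []; _∷_)
import Data.List.Relation.Unary.All.Properties as All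
open import Data.List.Relation.Unary.AllPairs using ([]; _∷_)
open import Data.List.Relation.Unary.Unique.Propositional using (Unique)
import Data.List.Relation.Unary.Unique.Propositional.Properties as Unique
open import Data.List.Relation.Binary.BagAndSetEquality using (∼bag⇒↭)
open import Data.List.Relation.Binary.Permutation.Propositional as Perm using (_↭_)
open import Data.Product.Base using (∃; _×_; _,_; proj₁; proj₂)
open import Data.Product.Properties using (,-injectiveˡ; ,-injectiveʳ)
open import Data.Sum.Base using (_⊎_; inj₁; inj₂)
open import Data.Empty using (⊥; ⊥-elim)
open import Function.Base using (_∘_; id)
open import Algebra.Bundles using (CommutativeSemiring)
open import Relation.Binary.PropositionalEquality as ≡ using (_≡_; _≢_; cong; cong₂; subst; subst₂)

-- The set 𝔇₂ₙ is not stable under inversion: 3142 belongs to it, its inverse 2413 does not. So the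
-- sums are extended to all permutations, an index that violates the condition receiving the factor
-- 0; then σ may be replaced by σ⁻¹ with the condition carried along in the weight. These zeros also
-- give the parity pattern. Step weights with σ(k) > k survive only at odd k, those with σ(k) < k
-- only at even k, so an odd step never falls and an even step never rises. In a pair of steps A_h
-- B_h and E_h F_h appear as products, namely α_{2h+1} and, for h ≥ 1, α_{2h}; at height 0 the
-- product E_0 F_0 is δ_1. Height h of a path thus meets the product T₁ ⋯ T_{2h+1}. Fixed points fit
-- in because of the balance between open positions and waiting values: as many larger entries
-- precede a fixed point as smaller ones follow it, so psnest is the height h, for σ and for σ⁻¹
-- alike. A semiring has no subtraction, so the fraction enters only through T_j = 1 + t (δ_j + α_j
-- T_{j+1}) T_j and never through an inverse series.

module Sums {c ℓ : Level} (R : CommutativeSemiring c ℓ) where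
  open CommutativeSemiring R hiding (zero)
  open import Algebra.Properties.CommutativeSemigroup +-commutativeSemigroup
    using (interchange; x∙yz≈y∙xz)
  open import Relation.Binary.Reasoning.Setoid setoid

  -- Sums over lists in a commutative semiring.

  ∑ ∏ : {A : Set} → List A → (A → Carrier) → Carrier
  ∑ = sumOver R
  ∏ = prodOver R

  ∑-cong : {A : Set} (xs : List A) {f g : A → Carrier} →
           (∀ {x} → x ∈ xs → f x ≈ g x) → ∑ xs f ≈ ∑ xs g
  ∑-cong []       h = refl
  ∑-cong (x ∷ xs) h = +-cong (h (here ≡.refl)) (∑-cong xs (h ∘ there))

  ∑-++ : {A : Set} (xs ys : List A) (f : A → Carrier) → ∑ (xs ++ ys) f ≈ ∑ xs f + ∑ ys f
  ∑-++ []       ys f = sym (+-identityˡ _)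
  ∑-++ (x ∷ xs) ys f = trans (+-congˡ (∑-++ xs ys f)) (sym (+-assoc _ _ _))

  ∑-map : {A B : Set} (h : A → B) (xs : List A) (f : B → Carrier) → ∑ (map h xs) f ≡ ∑ xs (f ∘ h)
  ∑-map h []       f = ≡.refl
  ∑-map h (x ∷ xs) f = cong (f (h x) +_) (∑-map h xs f)

  ∑-concatMap : {A B : Set} (h : A → List B) (xs : List A) (f : B → Carrier) →
                ∑ (concatMap h xs) f ≈ ∑ xs (λ x → ∑ (h x) f)
  ∑-concatMap h []       f = refl
  ∑-concatMap h (x ∷ xs) f = trans (∑-++ (h x) _ f) (+-congˡ (∑-concatMap h xs f))

  ∑-+ : {A : Set} (xs : List A) (f g : A → Carrier) → ∑ xs (λ x → f x + g x) ≈ ∑ xs f + ∑ xs g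
  ∑-+ []       f g = sym (+-identityˡ _)
  ∑-+ (x ∷ xs) f g = trans (+-congˡ (∑-+ xs f g)) (interchange _ _ _ _)

  ∑-0 : {A : Set} (xs : List A) {f : A → Carrier} → (∀ {x} → x ∈ xs → f x ≈ 0#) → ∑ xs f ≈ 0#
  ∑-0 []       h = refl
  ∑-0 (x ∷ xs) h = trans (+-cong (h (here ≡.refl)) (∑-0 xs (h ∘ there))) (+-identityˡ _)

  ∑-*ˡ : {A : Set} (y : Carrier) (xs : List A) (f : A → Carrier) → ∑ xs (λ x → y * f x) ≈ y * ∑ xs f
  ∑-*ˡ y []       f = sym (zeroʳ y)
  ∑-*ˡ y (x ∷ xs) f = trans (+-congˡ (∑-*ˡ y xs f)) (sym (distribˡ _ _ _))

  ∑-*ʳ : {A : Set} (y : Carrier) (xs : List A) (f : A → Carrier) → ∑ xs (λ x → f x * y) ≈ ∑ xs f * y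
  ∑-*ʳ y xs f = trans (∑-cong xs (λ _ → *-comm _ _)) (trans (∑-*ˡ y xs f) (*-comm _ _))

  ∑-swap : {A B : Set} (xs : List A) (ys : List B) (f : A → B → Carrier) →
           ∑ xs (λ x → ∑ ys (f x)) ≈ ∑ ys (λ y → ∑ xs (λ x → f x y))
  ∑-swap []       ys f = sym (∑-0 ys (λ _ → refl))
  ∑-swap (x ∷ xs) ys f = trans (+-congˡ (∑-swap xs ys f)) (sym (∑-+ ys _ _))

  ∑-single : {A : Set} {xs : List A} {p : A} {f : A → Carrier} → Unique xs → p ∈ xs →
             (∀ {q} → q ∈ xs → q ≢ p → f q ≈ 0#) → ∑ xs f ≈ f p
  ∑-single {xs = x ∷ xs} (x∉ ∷ u) (here ≡.refl) h =
    trans (+-congˡ (∑-0 xs (λ q∈ → h (there q∈) (λ q≡x → All.lookup x∉ q∈ (≡.sym q≡x))))) (+-identityʳ _)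
  ∑-single {xs = x ∷ xs} (x∉ ∷ u) (there p∈) h =
    trans (+-cong (h (here ≡.refl) (All.lookup x∉ p∈)) (∑-single u p∈ (h ∘ there))) (+-identityˡ _)

  ∑-↭ : {A : Set} {xs ys : List A} {f : A → Carrier} → xs ↭ ys → ∑ xs f ≈ ∑ ys f
  ∑-↭ Perm.refl         = refl
  ∑-↭ (Perm.prep x p)   = +-congˡ (∑-↭ p)
  ∑-↭ (Perm.swap x y p) = trans (+-congˡ (+-congˡ (∑-↭ p))) (x∙yz≈y∙xz _ _ _)
  ∑-↭ (Perm.trans p q)  = trans (∑-↭ p) (∑-↭ q)

  ∑-boolFilter : {A : Set} (p : A → Bool) (xs : List A) (f : A → Carrier) →
                 ∑ (boolFilter p xs) f ≈ ∑ xs (λ x → if p x then f x else 0#)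
  ∑-boolFilter p []       f = refl
  ∑-boolFilter p (x ∷ xs) f with p x
  ... | true  = +-congˡ (∑-boolFilter p xs f)
  ... | false = trans (∑-boolFilter p xs f) (sym (+-identityˡ _))

  ∑-upTo-suc : (n : ℕ) (f : ℕ → Carrier) → ∑ (upTo (suc n)) f ≡ f 0 + ∑ (upTo n) (f ∘ suc)
  ∑-upTo-suc n f = cong (f 0 +_)
    (≡.trans (cong (λ xs → ∑ xs f) (≡.sym (map-upTo suc n))) (∑-map suc (upTo n) f))

-- Coefficient recurrences of the T-fraction.

module TFraction {c ℓ : Level} (R : CommutativeSemiring c ℓ) where
  open CommutativeSemiring R hiding (zero)
  open Sums R
  open import Relation.Binary.Reasoning.Setoid setoid
  open import Data.List.Membership.Propositional.Properties using (∈-upTo⁻)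

  infixl 7 _⊛_
  -- The Cauchy product, peeled at the constant term of the first factor: in this form associativity
  -- is a plain induction, without reindexing of double sums.
  _⊛_ : (ℕ → Carrier) → (ℕ → Carrier) → ℕ → Carrier
  (f ⊛ g) zero    = f 0 * g 0
  (f ⊛ g) (suc m) = f 0 * g (suc m) + ((f ∘ suc) ⊛ g) m

  ∑≈⊛ : (f g : ℕ → Carrier) (m : ℕ) → ∑ (upTo (suc m)) (λ k → f k * g (m ∸ k)) ≈ (f ⊛ g) m
  ∑≈⊛ f g zero    = +-identityʳ _
  ∑≈⊛ f g (suc m) = trans (reflexive (∑-upTo-suc (suc m) (λ k → f k * g (suc m ∸ k))))
                          (+-congˡ (∑≈⊛ (f ∘ suc) g m))

  ⊛-congʳ : {f f′ : ℕ → Carrier} (g : ℕ → Carrier) → (∀ k → f k ≈ f′ k) → ∀ m → (f ⊛ g) m ≈ (f′ ⊛ g) m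
  ⊛-congʳ g h zero    = *-congʳ (h 0)
  ⊛-congʳ g h (suc m) = +-cong (*-congʳ (h 0)) (⊛-congʳ g (h ∘ suc) m)

  ⊛-distribʳ : (f f′ g : ℕ → Carrier) → ∀ m → ((λ k → f k + f′ k) ⊛ g) m ≈ (f ⊛ g) m + (f′ ⊛ g) m
  ⊛-distribʳ f f′ g zero    = distribʳ _ _ _
  ⊛-distribʳ f f′ g (suc m) = begin
    (f 0 + f′ 0) * g (suc m) + ((λ k → f (suc k) + f′ (suc k)) ⊛ g) m
      ≈⟨ +-cong (distribʳ _ _ _) (⊛-distribʳ (f ∘ suc) (f′ ∘ suc) g m) ⟩
    (f 0 * g (suc m) + f′ 0 * g (suc m)) + (((f ∘ suc) ⊛ g) m + ((f′ ∘ suc) ⊛ g) m)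
      ≈⟨ interchange _ _ _ _ ⟩
    (f ⊛ g) (suc m) + (f′ ⊛ g) (suc m) ∎
    where open import Algebra.Properties.CommutativeSemigroup +-commutativeSemigroup using (interchange)

  ⊛-*ˡ : (x : Carrier) (f g : ℕ → Carrier) → ∀ m → ((λ k → x * f k) ⊛ g) m ≈ x * (f ⊛ g) m
  ⊛-*ˡ x f g zero    = *-assoc _ _ _
  ⊛-*ˡ x f g (suc m) = trans (+-cong (*-assoc _ _ _) (⊛-*ˡ x (f ∘ suc) g m)) (sym (distribˡ _ _ _))

  ⊛-assoc : (f g h : ℕ → Carrier) → ∀ m → ((f ⊛ g) ⊛ h) m ≈ (f ⊛ (g ⊛ h)) m
  ⊛-assoc f g h zero    = *-assoc _ _ _
  ⊛-assoc f g h (suc m) = begin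
    f 0 * g 0 * h (suc m) + ((λ k → f 0 * g (suc k) + ((f ∘ suc) ⊛ g) k) ⊛ h) m
      ≈⟨ +-cong (*-assoc _ _ _) (⊛-distribʳ (λ k → f 0 * g (suc k)) ((f ∘ suc) ⊛ g) h m) ⟩
    f 0 * (g 0 * h (suc m)) + (((λ k → f 0 * g (suc k)) ⊛ h) m + (((f ∘ suc) ⊛ g) ⊛ h) m)
      ≈⟨ +-congˡ (+-cong (⊛-*ˡ (f 0) (g ∘ suc) h m) (⊛-assoc (f ∘ suc) g h m)) ⟩
    f 0 * (g 0 * h (suc m)) + (f 0 * ((g ∘ suc) ⊛ h) m + ((f ∘ suc) ⊛ (g ⊛ h)) m)
      ≈⟨ +-assoc _ _ _ ⟨
    f 0 * (g 0 * h (suc m)) + f 0 * ((g ∘ suc) ⊛ h) m + ((f ∘ suc) ⊛ (g ⊛ h)) m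
      ≈⟨ +-congʳ (distribˡ _ _ _) ⟨
    (f ⊛ (g ⊛ h)) (suc m) ∎

  module _ (α δ : ℕ → Carrier) where

    private
      it : ℕ → ℕ → ℕ → Carrier
      it = iter R α δ

    T : ℕ → ℕ → Carrier
    T j m = it m j m

    -- A coefficient of degree m + 1 is computed from coefficients of degree at most m of the
    -- preceding iteration, so stability spreads by one degree per iteration.
    iter-suc : ∀ n j {m} → m ≤ n → it (suc n) j m ≈ it n j m
    iter-suc zero    j z≤n       = refl
    iter-suc (suc n) j z≤n       = refl
    iter-suc (suc n) j {suc m} (s≤s m≤n) = ∑-cong (upTo (suc m)) step
      where
      step : ∀ {k} → k ∈ upTo (suc m) →
        ((if k ≡ᵇ 0 then δ j else 0#) + α j * it (suc n) (suc j) k) * it (suc n) j (m ∸ k) ≈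
        ((if k ≡ᵇ 0 then δ j else 0#) + α j * it n (suc j) k) * it n j (m ∸ k)
      step {k} k∈ with ∈-upTo⁻ k∈
      ... | s≤s k≤m = *-cong (+-congˡ (*-congˡ (iter-suc n (suc j) (ℕ.≤-trans k≤m m≤n))))
                             (iter-suc n j (ℕ.≤-trans (m∸n≤m m k) m≤n))

    iter≈T : ∀ d j m → it (d ℕ.+ m) j m ≈ T j m
    iter≈T zero    j m = refl
    iter≈T (suc d) j m = trans (iter-suc (d ℕ.+ m) j (m≤n+m m d)) (iter≈T d j m)

    -- The functional equation of T_j at degree m + 1; stability lets the truncated iterates be
    -- replaced by the exact series.
    T-suc : ∀ j m → T j (suc m) ≈ δ j * T j m + α j * (T (suc j) ⊛ T j) m
    T-suc j m = begin
      T j (suc m)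
        ≈⟨ ∑-cong (upTo (suc m)) step ⟩
      ∑ (upTo (suc m)) (λ k → (δ′ k + α j * T (suc j) k) * T j (m ∸ k))
        ≈⟨ ∑≈⊛ _ (T j) m ⟩
      ((λ k → δ′ k + α j * T (suc j) k) ⊛ T j) m
        ≈⟨ ⊛-distribʳ δ′ _ (T j) m ⟩
      (δ′ ⊛ T j) m + ((λ k → α j * T (suc j) k) ⊛ T j) m
        ≈⟨ +-cong (const m) (⊛-*ˡ (α j) (T (suc j)) (T j) m) ⟩
      δ j * T j m + α j * (T (suc j) ⊛ T j) m ∎
      where
      δ′ : ℕ → Carrier
      δ′ k = if k ≡ᵇ 0 then δ j else 0#
      const : ∀ m → (δ′ ⊛ T j) m ≈ δ j * T j m
      const zero    = refl
      const (suc m) = trans (+-congˡ (nil m)) (+-identityʳ _)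
        where
        nil : ∀ m → ((λ _ → 0#) ⊛ T j) m ≈ 0#
        nil zero    = zeroˡ _
        nil (suc m) = trans (+-cong (zeroˡ _) (nil m)) (+-identityˡ _)
      stable : ∀ {n k} j → k ≤ n → it n j k ≈ T j k
      stable {n} {k} j k≤n = trans (reflexive (cong (λ n → it n j k) (≡.sym (m∸n+n≡m k≤n)))) (iter≈T (n ∸ k) j k)
      step : ∀ {k} → k ∈ upTo (suc m) →
        (δ′ k + α j * it m (suc j) k) * it m j (m ∸ k) ≈ (δ′ k + α j * T (suc j) k) * T j (m ∸ k)
      step {k} k∈ with ∈-upTo⁻ k∈
      ... | s≤s k≤m = *-cong (+-congˡ (*-congˡ (stable (suc j) k≤m))) (stable j (m∸n≤m m k))

    -- U j = T₁ T₂ ⋯ T_{j+1} is, up to a power of t and the weights of the falls,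
    -- the generating function of the Dyck paths from height j to height 0.
    U : ℕ → ℕ → Carrier
    U zero    = T 1
    U (suc j) = T (suc (suc j)) ⊛ U j

    U-0 : ∀ j → U j 0 ≈ 1#
    U-0 zero    = refl
    U-0 (suc j) = trans (*-identityˡ _) (U-0 j)

    U-zero-suc : ∀ m → U 0 (suc m) ≈ δ 1 * U 0 m + α 1 * U 1 m
    U-zero-suc = T-suc 1

    -- Multiply T_{j+2} = 1 + t α_{j+2} T_{j+3} T_{j+2} by U_j: this reads U_{j+1} = U_j + t α_{j+2}
    -- U_{j+2}.
    U-suc-suc : ∀ j m → δ (suc (suc j)) ≈ 0# →
                U (suc j) (suc m) ≈ U j (suc m) + α (suc (suc j)) * U (suc (suc j)) m
    U-suc-suc j m δ≈0 = +-cong (*-identityˡ _) (begin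
      ((T j₂ ∘ suc) ⊛ U j) m
        ≈⟨ ⊛-congʳ (U j) (λ k → trans (T-suc j₂ k) (trans (+-congʳ (trans (*-congʳ δ≈0) (zeroˡ _))) (+-identityˡ _))) m ⟩
      ((λ k → α j₂ * (T (suc j₂) ⊛ T j₂) k) ⊛ U j) m
        ≈⟨ ⊛-*ˡ (α j₂) (T (suc j₂) ⊛ T j₂) (U j) m ⟩
      α j₂ * ((T (suc j₂) ⊛ T j₂) ⊛ U j) m
        ≈⟨ *-congˡ (⊛-assoc (T (suc j₂)) (T j₂) (U j) m) ⟩
      α j₂ * (T (suc j₂) ⊛ (T j₂ ⊛ U j)) m ∎)
      where j₂ = suc (suc j)

-- Unlike 2 * n, this unfolds to two successors at once, so a pair of steps of a path can be
-- unrolled by computation.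
double : ℕ → ℕ
double zero    = zero
double (suc h) = suc (suc (double h))

-- Weighted Motzkin paths with alternating step weights and the T-fraction.

module Paths {c ℓ : Level} (R : CommutativeSemiring c ℓ) where
  open CommutativeSemiring R hiding (zero)
  open Sums R
  open import Relation.Binary.Reasoning.Setoid setoid

  -- Weighted Motzkin paths with m steps from height h after step k down to height 0;
  -- fall j h is the weight of the fall from height h + 1 in step j.
  module _ (rise level fall : ℕ → ℕ → Carrier) where

    path : ℕ → ℕ → ℕ → Carrier
    path k zero    zero    = 1#
    path k zero    (suc h) = 0#
    path k (suc m) zero    =
      rise (suc k) 0 * path (suc k) m 1 + level (suc k) 0 * path (suc k) m 0
    path k (suc m) (suc h) =
      rise (suc k) (suc h) * path (suc k) m (suc (suc h)) + level (suc k) (suc h) * path (suc k) m (suc h)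
        + fall (suc k) h * path (suc k) m h

  path-cong : {rise rise′ level level′ fall fall′ : ℕ → ℕ → Carrier} →
              (∀ k h → rise k h ≈ rise′ k h) → (∀ k h → level k h ≈ level′ k h) →
              (∀ k h → fall k h ≈ fall′ k h) →
              ∀ k m h → path rise level fall k m h ≈ path rise′ level′ fall′ k m h
  path-cong r l f k zero    zero    = refl
  path-cong r l f k zero    (suc h) = refl
  path-cong r l f k (suc m) zero    =
    +-cong (*-cong (r _ _) (path-cong r l f (suc k) m 1)) (*-cong (l _ _) (path-cong r l f (suc k) m 0))
  path-cong r l f k (suc m) (suc h) =
    +-cong (+-cong (*-cong (r _ _) (path-cong r l f (suc k) m (suc (suc h))))
                   (*-cong (l _ _) (path-cong r l f (suc k) m (suc h))))
           (*-cong (f _ _) (path-cong r l f (suc k) m h))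

  alternate : (even odd : ℕ → Carrier) → ℕ → ℕ → Carrier
  alternate even odd k h = if isEven k then even h else odd h

  module _ (A B E F : ℕ → Carrier) (α δ : ℕ → Carrier)
           (α-even : ∀ h → α (double (suc h)) ≈ E (suc h) * F (suc h))
           (α-odd : ∀ h → α (suc (double h)) ≈ A h * B h)
           (δ-one : δ 1 ≈ E 0 * F 0) (δ-two+ : ∀ j → δ (suc (suc j)) ≈ 0#) where

    open TFraction R
    open import Algebra.Solver.Ring.NaturalCoefficients.Default R using (solve; _:=_; _:+_; _:*_)

    private
      V : ℕ → ℕ → Carrier
      V = U α δ

      P : ℕ → ℕ → ℕ → Carrier
      P = path (alternate (λ _ → 0#) A) (alternate E F) (alternate B (λ _ → 0#))

    delay : (ℕ → Carrier) → ℕ → Carrier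
    delay f zero    = 0#
    delay f (suc m) = f m

    -- Multiplication of a series by t^h; `delay` is multiplication by t.
    shift : ℕ → (ℕ → Carrier) → ℕ → Carrier
    shift zero    f = f
    shift (suc h) f = shift h (delay f)

    delay-cong : {f g : ℕ → Carrier} → (∀ m → f m ≈ g m) → ∀ m → delay f m ≈ delay g m
    delay-cong h zero    = refl
    delay-cong h (suc m) = h m

    delay-linear : ∀ f x g m → delay (λ m → f m + x * g m) m ≈ delay f m + x * delay g m
    delay-linear f x g zero    = sym (trans (+-identityˡ _) (zeroʳ x))
    delay-linear f x g (suc m) = refl

    shift-cong : ∀ h {f g : ℕ → Carrier} → (∀ m → f m ≈ g m) → ∀ m → shift h f m ≈ shift h g m
    shift-cong zero    e = e
    shift-cong (suc h) e = shift-cong h (delay-cong e)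

    shift-linear : ∀ h f x g m → shift h (λ m → f m + x * g m) m ≈ shift h f m + x * shift h g m
    shift-linear zero    f x g m = refl
    shift-linear (suc h) f x g m =
      trans (shift-cong h (delay-linear f x g) m) (shift-linear h (delay f) x (delay g) m)

    shift-zero : ∀ h f → shift (suc h) f 0 ≈ 0#
    shift-zero zero    f = refl
    shift-zero (suc h) f = shift-zero h (delay f)

    shift-suc : ∀ h f m → shift (suc h) f (suc m) ≈ shift h f m
    shift-suc zero    f m = refl
    shift-suc (suc h) f m = shift-suc h (delay f) m

    V-suc : ∀ j m → V (suc j) m ≈ V j m + α (suc (suc j)) * delay (V (suc (suc j))) m
    V-suc j zero    = trans (U-0 α δ (suc j))
      (trans (sym (U-0 α δ j)) (sym (trans (+-congˡ (zeroʳ _)) (+-identityʳ _))))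
    V-suc j (suc m) = U-suc-suc α δ j m (δ-two+ j)

    shift-V-suc : ∀ h j m → shift h (V (suc j)) m ≈
                  shift h (V j) m + α (suc (suc j)) * shift (suc h) (V (suc (suc j))) m
    shift-V-suc h j m = trans (shift-cong h (V-suc j) m) (shift-linear h (V j) _ _ m)

    -- The coefficients of t^h U_{2h}. One unit of height is two levels of the fraction, and t^h
    -- accounts for the h pairs of steps that a descent from height h takes at least.
    X : ℕ → ℕ → Carrier
    X m h = shift h (V (double h)) m

    X-rec₀ : ∀ m → X (suc m) 0 ≈ E 0 * F 0 * X m 0 + A 0 * B 0 * (X m 0 + E 1 * F 1 * X m 1)
    X-rec₀ m = begin
      X (suc m) 0                             ≈⟨ U-zero-suc α δ m ⟩
      δ 1 * X m 0 + α 1 * V 1 m               ≈⟨ +-cong (*-congʳ δ-one) (*-cong (α-odd 0) (shift-V-suc 0 0 m)) ⟩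
      E 0 * F 0 * X m 0 + A 0 * B 0 * (X m 0 + α 2 * X m 1)
        ≈⟨ +-congˡ (*-congˡ (+-congˡ (*-congʳ (α-even 0)))) ⟩
      E 0 * F 0 * X m 0 + A 0 * B 0 * (X m 0 + E 1 * F 1 * X m 1) ∎

    -- The recurrence of U is applied to U_{2h+2} and then to the two odd-indexed products U_{2h+1}
    -- and U_{2h+3} that come up, which leaves even indices only.
    X-rec : ∀ m h → let h₁ = suc h ; h₂ = suc h₁ in
            X (suc m) h₁ ≈ (X m h + E h₁ * F h₁ * X m h₁) + A h₁ * B h₁ * (X m h₁ + E h₂ * F h₂ * X m h₂)
    X-rec m h = begin
      X (suc m) (suc h)                   ≈⟨ shift-suc h _ m ⟩
      shift h (V (double (suc h))) m      ≈⟨ shift-V-suc h (suc (double h)) m ⟩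
      shift h (V (suc (double h))) m + α (suc (double (suc h))) * shift (suc h) (V (suc (double (suc h)))) m
        ≈⟨ +-cong (shift-V-suc h (double h) m) (*-cong (α-odd (suc h)) (shift-V-suc (suc h) (double (suc h)) m)) ⟩
      (X m h + α (double (suc h)) * X m (suc h))
        + A (suc h) * B (suc h) * (X m (suc h) + α (double (suc (suc h))) * X m (suc (suc h)))
        ≈⟨ +-cong (+-congˡ (*-congʳ (α-even h))) (*-congˡ (+-congˡ (*-congʳ (α-even (suc h))))) ⟩
      _ ∎

    -- A net fall from h + 1 to h has weight F (suc h) * B h: a level step at odd time, then a fall.
    -- The recurrence of `X` has falls of weight 1 and carries these factors on its rises instead;
    -- this product converts one normalisation into the other.
    falls : ℕ → Carrier
    falls zero    = 1#
    falls (suc h) = falls h * (B h * F (suc h))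

    isEven-suc : ∀ {k} → isEven k ≡ true → isEven (suc k) ≡ false
    isEven-suc e = cong not e

    isEven-suc² : ∀ {k} → isEven k ≡ true → isEven (suc (suc k)) ≡ true
    isEven-suc² e = cong (λ b → not (not b)) e

    P-odd₀ : ∀ k m → isEven k ≡ true → P k (suc m) 0 ≈ A 0 * P (suc k) m 1 + F 0 * P (suc k) m 0
    P-odd₀ k m e rewrite e = refl

    P-odd : ∀ k m h → isEven k ≡ true → P k (suc m) (suc h) ≈
            A (suc h) * P (suc k) m (suc (suc h)) + F (suc h) * P (suc k) m (suc h)
    P-odd k m h e rewrite e = trans (+-congˡ (zeroˡ _)) (+-identityʳ _)

    P-even₀ : ∀ k m → isEven k ≡ false → P k (suc m) 0 ≈ E 0 * P (suc k) m 0
    P-even₀ k m e rewrite e = trans (+-congʳ (zeroˡ _)) (+-identityˡ _)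

    P-even : ∀ k m h → isEven k ≡ false → P k (suc m) (suc h) ≈ E (suc h) * P (suc k) m (suc h) + B h * P (suc k) m h
    P-even k m h e rewrite e = +-congʳ (trans (+-congʳ (zeroˡ _)) (+-identityˡ _))

    -- Above height 0 a pair of steps (rise or level, then level or fall) has four outcomes; once
    -- the factor `falls` is extracted they are the four terms of the recurrence of `X`.
    path≈X : ∀ k m h → isEven k ≡ true → P k (double m) h ≈ falls h * X m h
    path≈X k zero    zero    e = sym (*-identityˡ _)
    path≈X k zero    (suc h) e = sym (trans (*-congˡ (shift-zero h _)) (zeroʳ _))
    path≈X k (suc m) zero    e = begin
      P k (double (suc m)) 0
        ≈⟨ P-odd₀ k (suc (double m)) e ⟩
      A 0 * P (suc k) (suc (double m)) 1 + F 0 * P (suc k) (suc (double m)) 0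
        ≈⟨ +-cong (*-congˡ (P-even (suc k) (double m) 0 e′)) (*-congˡ (P-even₀ (suc k) (double m) e′)) ⟩
      A 0 * (E 1 * P k₂ (double m) 1 + B 0 * P k₂ (double m) 0) + F 0 * (E 0 * P k₂ (double m) 0)
        ≈⟨ +-cong (*-congˡ (+-cong (*-congˡ (IH 1)) (*-congˡ (IH 0)))) (*-congˡ (*-congˡ (IH 0))) ⟩
      A 0 * (E 1 * (1# * (B 0 * F 1) * X m 1) + B 0 * (1# * X m 0)) + F 0 * (E 0 * (1# * X m 0))
        -- The unit `falls 0` enters as a variable `o`, which every term contains exactly once.
        ≈⟨ solve 9 (λ a e₁ o b f₁ x₁ x₀ f₀ e₀ →
             a :* (e₁ :* (o :* (b :* f₁) :* x₁) :+ b :* (o :* x₀)) :+ f₀ :* (e₀ :* (o :* x₀))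
               := o :* (e₀ :* f₀ :* x₀ :+ a :* b :* (x₀ :+ e₁ :* f₁ :* x₁)))
             refl (A 0) (E 1) 1# (B 0) (F 1) (X m 1) (X m 0) (F 0) (E 0) ⟩
      1# * (E 0 * F 0 * X m 0 + A 0 * B 0 * (X m 0 + E 1 * F 1 * X m 1))
        ≈⟨ *-congˡ (X-rec₀ m) ⟨
      1# * X (suc m) 0 ∎
      where
      k₂ = suc (suc k)
      e′ = isEven-suc {k} e
      IH = λ h → path≈X k₂ m h (isEven-suc² {k} e)
    path≈X k (suc m) (suc h) e = begin
      P k (double (suc m)) h₁
        ≈⟨ P-odd k (suc (double m)) h e ⟩
      A h₁ * P (suc k) (suc (double m)) h₂ + F h₁ * P (suc k) (suc (double m)) h₁
        ≈⟨ +-cong (*-congˡ (P-even (suc k) (double m) h₁ e′)) (*-congˡ (P-even (suc k) (double m) h e′)) ⟩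
      A h₁ * (E h₂ * P k₂ (double m) h₂ + B h₁ * P k₂ (double m) h₁)
        + F h₁ * (E h₁ * P k₂ (double m) h₁ + B h * P k₂ (double m) h)
        ≈⟨ +-cong (*-congˡ (+-cong (*-congˡ (IH h₂)) (*-congˡ (IH h₁))))
                  (*-congˡ (+-cong (*-congˡ (IH h₁)) (*-congˡ (IH h)))) ⟩
      A h₁ * (E h₂ * (w * (B h * F h₁) * (B h₁ * F h₂) * X m h₂) + B h₁ * (w * (B h * F h₁) * X m h₁))
        + F h₁ * (E h₁ * (w * (B h * F h₁) * X m h₁) + B h * (w * X m h))
        ≈⟨ solve 11 (λ a₁ e₂ w b f₁ b₁ f₂ x₂ x₁ e₁ x →
             a₁ :* (e₂ :* (w :* (b :* f₁) :* (b₁ :* f₂) :* x₂) :+ b₁ :* (w :* (b :* f₁) :* x₁))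
               :+ f₁ :* (e₁ :* (w :* (b :* f₁) :* x₁) :+ b :* (w :* x))
             := w :* (b :* f₁) :* ((x :+ e₁ :* f₁ :* x₁) :+ a₁ :* b₁ :* (x₁ :+ e₂ :* f₂ :* x₂)))
             refl (A h₁) (E h₂) w (B h) (F h₁) (B h₁) (F h₂) (X m h₂) (X m h₁) (E h₁) (X m h) ⟩
      w * (B h * F h₁) * ((X m h + E h₁ * F h₁ * X m h₁) + A h₁ * B h₁ * (X m h₁ + E h₂ * F h₂ * X m h₂))
        ≈⟨ *-congˡ (X-rec m h) ⟨
      falls h₁ * X (suc m) h₁ ∎
      where
      w = falls h
      h₁ = suc h
      h₂ = suc h₁
      k₂ = suc (suc k)
      e′ = isEven-suc {k} e
      IH = λ h → path≈X k₂ m h (isEven-suc² {k} e)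

    path≈TFrac : ∀ m → P 0 (double m) 0 ≈ TFrac R α δ m
    path≈TFrac m = trans (path≈X 0 m 0 ≡.refl) (*-identityˡ _)

-- Counting, lists without repetition, and permutations as words.

module Combinatorics where

  open import Data.Nat.Base using (_+_)
  open import Data.Nat.Properties
  open import Data.Bool.Base using (T)
  open import Data.Bool.Properties using (T-≡; ∧-zeroʳ; ∧-identityʳ; ∧-comm; ∧-assoc)
  open import Function.Bundles using (Equivalence; mk⇔)
  open import Relation.Nullary.Decidable using (yes; no)
  open ≡ using (refl; sym; trans; module ≡-Reasoning)
  open Sums +-*-commutativeSemiring

  true⇒T : ∀ {b} → b ≡ true → T b
  true⇒T = Equivalence.from T-≡

  T⇒true : ∀ {b} → T b → b ≡ true
  T⇒true = Equivalence.to T-≡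

  <ᵇ-true : ∀ {m n} → m < n → (m <ᵇ n) ≡ true
  <ᵇ-true m<n = T⇒true (<⇒<ᵇ m<n)

  <ᵇ-false : ∀ {m n} → n ≤ m → (m <ᵇ n) ≡ false
  <ᵇ-false {m} {n} n≤m with m <ᵇ n in eq
  ... | false = refl
  ... | true  = ⊥-elim (<⇒≱ (<ᵇ⇒< m n (true⇒T eq)) n≤m)

  ≡ᵇ-refl : ∀ n → (n ≡ᵇ n) ≡ true
  ≡ᵇ-refl n = T⇒true (≡⇒≡ᵇ n n refl)

  ≡ᵇ-true⁻ : ∀ {m n} → (m ≡ᵇ n) ≡ true → m ≡ n
  ≡ᵇ-true⁻ {m} {n} e = ≡ᵇ⇒≡ m n (true⇒T e)

  ≡ᵇ-false : ∀ {m n} → m ≢ n → (m ≡ᵇ n) ≡ false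
  ≡ᵇ-false {m} {n} m≢n with m ≡ᵇ n in eq
  ... | false = refl
  ... | true  = ⊥-elim (m≢n (≡ᵇ-true⁻ eq))

  ⟦_⟧ : Bool → ℕ
  ⟦ true  ⟧ = 1
  ⟦ false ⟧ = 0

  -- A sum of indicators in the semiring ℕ, so that the lemmas on sums, above all exchange and
  -- collapse, apply to counting.
  count : {A : Set} → (A → Bool) → List A → ℕ
  count p xs = ∑ xs (λ x → ⟦ p x ⟧)

  countB≡count : {A : Set} (p : A → Bool) (xs : List A) → countB p xs ≡ count p xs
  countB≡count p []       = refl
  countB≡count p (x ∷ xs) with p x
  ... | true  = cong suc (countB≡count p xs)
  ... | false = countB≡count p xs

  occ : ℕ → List ℕ → ℕ
  occ v = count (_≡ᵇ v)

  occ-++ : ∀ v xs ys → occ v (xs ++ ys) ≡ occ v xs + occ v ys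
  occ-++ v xs ys = ∑-++ xs ys _

  occ-∷-≡ : ∀ v xs → occ v (v ∷ xs) ≡ suc (occ v xs)
  occ-∷-≡ v xs = cong (λ b → ⟦ b ⟧ + occ v xs) (≡ᵇ-refl v)

  occ-∷-≢ : ∀ {v x} xs → x ≢ v → occ v (x ∷ xs) ≡ occ v xs
  occ-∷-≢ {v} xs x≢v = cong (λ b → ⟦ b ⟧ + occ v xs) (≡ᵇ-false x≢v)

  ∉⇒occ≡0 : ∀ {v xs} → All (_≢ v) xs → occ v xs ≡ 0
  ∉⇒occ≡0 []         = refl
  ∉⇒occ≡0 {xs = x ∷ xs} (p ∷ ps) = trans (occ-∷-≢ xs p) (∉⇒occ≡0 ps)

  occ≡0⇒∉ : ∀ {v} xs → occ v xs ≡ 0 → All (_≢ v) xs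
  occ≡0⇒∉ []       e = []
  occ≡0⇒∉ {v} (x ∷ xs) e = x≢v ∷ occ≡0⇒∉ xs (trans (sym (occ-∷-≢ xs x≢v)) e)
    where
    x≢v : x ≢ v
    x≢v refl with () ← trans (sym (occ-∷-≡ v xs)) e

  ∈⇒occ>0 : ∀ {v xs} → v ∈ xs → 0 < occ v xs
  ∈⇒occ>0 {v} {xs} v∈ with occ v xs in eq
  ... | suc _ = s≤s z≤n
  ... | zero  = ⊥-elim (All.lookup (occ≡0⇒∉ xs eq) v∈ refl)

  occ-split : ∀ v xs {n} → occ v xs ≡ suc n → ∃ λ ys → ∃ λ zs → xs ≡ ys ++ v ∷ zs
  occ-split v (x ∷ xs) e with x ≟ v
  ... | yes refl = [] , xs , refl
  ... | no x≢v with ys , zs , refl ← occ-split v xs (trans (sym (occ-∷-≢ xs x≢v)) e) = x ∷ ys , zs , refl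

  ∈-range⁺ : ∀ {N i} → 1 ≤ i → i ≤ N → i ∈ range N
  ∈-range⁺ {i = suc i} _ i<N = ∈-map⁺ suc (∈-upTo⁺ i<N)

  ∈-range⁻ : ∀ {N i} → i ∈ range N → 1 ≤ i × i ≤ N
  ∈-range⁻ i∈ with _ , j∈ , refl ← ∈-map⁻ suc i∈ = s≤s z≤n , ∈-upTo⁻ j∈

  range-unique : ∀ N → Unique (range N)
  range-unique N = Unique.map⁺ suc-injective (Unique.upTo⁺ N)

  ∑-range-single : ∀ {N p} {f : ℕ → ℕ} → p ∈ range N → (∀ {q} → q ∈ range N → q ≢ p → f q ≡ 0) →
                   ∑ (range N) f ≡ f p
  ∑-range-single {N} = ∑-single (range-unique N)

  -- From an element `g` recovers the branch that it came from, so distinct branches are disjoint.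
  -- For the insertion tree `g` is the way back to a node.
  concatMap-unique : {A B : Set} (f : A → List B) (g : B → A) {xs : List A} →
    (∀ {x y} → x ∈ xs → y ∈ f x → g y ≡ x) → (∀ {x} → x ∈ xs → Unique (f x)) →
    Unique xs → Unique (concatMap f xs)
  concatMap-unique f g h uf [] = []
  concatMap-unique f g {x ∷ xs} h uf (x∉ ∷ u) =
    Unique.++⁺ (uf (here refl)) (concatMap-unique f g (h ∘ there) (uf ∘ there) u) disjoint
    where
    disjoint : ∀ {y} → y ∈ f x × y ∈ concatMap f xs → ⊥
    disjoint (y∈ , y∈′) with _ , x′∈ , y∈″ ← find (∈-concatMap⁻ f {xs = xs} y∈′) =
      All.lookup x∉ x′∈ (trans (sym (h (here refl) y∈)) (h (there x′∈) y∈″))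

  map-unique : {A B : Set} (f : A → B) (g : B → A) {xs : List A} →
               (∀ {x} → x ∈ xs → g (f x) ≡ x) → Unique xs → Unique (map f xs)
  map-unique f g h [] = []
  map-unique f g {x ∷ xs} h (x∉ ∷ u) =
    All.map⁺ (All.tabulate (λ {y} y∈ e → All.lookup x∉ y∈
      (trans (sym (h (here refl))) (trans (cong g e) (h (there y∈)))))) ∷ map-unique f g (h ∘ there) u

  boolFilter-unique : {A : Set} (p : A → Bool) {xs : List A} → Unique xs → Unique (boolFilter p xs)
  ∈-boolFilter⁻ : {A : Set} (p : A → Bool) {xs : List A} {x : A} → x ∈ boolFilter p xs → x ∈ xs × p x ≡ true
  ∈-boolFilter⁻ p {y ∷ xs} x∈ with p y in eq | x∈
  ... | true  | here refl = here refl , eq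
  ... | true  | there x∈′ = let a , b = ∈-boolFilter⁻ p x∈′ in there a , b
  ... | false | x∈′       = let a , b = ∈-boolFilter⁻ p x∈′ in there a , b

  ∈-boolFilter⁺ : {A : Set} (p : A → Bool) {xs : List A} {x : A} → x ∈ xs → p x ≡ true → x ∈ boolFilter p xs
  ∈-boolFilter⁺ p {y ∷ xs} (here refl) e rewrite e = here refl
  ∈-boolFilter⁺ p {y ∷ xs} (there x∈) e with p y
  ... | true  = there (∈-boolFilter⁺ p x∈ e)
  ... | false = ∈-boolFilter⁺ p x∈ e

  boolFilter-unique p [] = []
  boolFilter-unique p {x ∷ xs} (x∉ ∷ u) with p x
  ... | true  = All.tabulate (λ y∈ → All.lookup x∉ (proj₁ (∈-boolFilter⁻ p y∈))) ∷ boolFilter-unique p u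
  ... | false = boolFilter-unique p u

  allB⁻ : {A : Set} (p : A → Bool) {xs : List A} {x : A} → allB p xs ≡ true → x ∈ xs → p x ≡ true
  allB⁻ p {y ∷ xs} e x∈ with p y in eq | x∈
  ... | true | here refl = eq
  ... | true | there x∈′ = allB⁻ p e x∈′

  allB⁺ : {A : Set} (p : A → Bool) (xs : List A) → (∀ {x} → x ∈ xs → p x ≡ true) → allB p xs ≡ true
  allB⁺ p []       h = refl
  allB⁺ p (x ∷ xs) h rewrite h (here refl) = allB⁺ p xs (h ∘ there)

  Within : ℕ → ℕ → Set
  Within N v = 1 ≤ v × v ≤ N

  ∈-words⁻ : ∀ m {k σ} → σ ∈ words m k → length σ ≡ m × All (Within k) σ
  ∈-words⁻ zero    (here refl) = refl , []
  ∈-words⁻ (suc m) {k} σ∈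
    with x , x∈ , τ∈ ← find (∈-concatMap⁻ (λ x → map (x ∷_) (words m k)) {xs = range k} σ∈)
    with τ , τ∈′ , refl ← ∈-map⁻ (x ∷_) τ∈ =
    let a , b = ∈-words⁻ m τ∈′ in cong suc a , ∈-range⁻ x∈ ∷ b

  ∈-words⁺ : ∀ {k σ} → All (Within k) σ → σ ∈ words (length σ) k
  ∈-words⁺ [] = here refl
  ∈-words⁺ {k} {x ∷ σ} ((x≥1 , x≤k) ∷ ps) =
    ∈-concatMap⁺ (λ x → map (x ∷_) (words (length σ) k)) {xs = range k}
      (lose (∈-range⁺ x≥1 x≤k) (∈-map⁺ (x ∷_) (∈-words⁺ ps)))

  words-unique : ∀ m k → Unique (words m k)
  words-unique zero    k = [] ∷ []
  words-unique (suc m) k = concatMap-unique (λ x → map (x ∷_) (words m k)) (λ σ → nth σ 0)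
    (λ {x} _ y∈ → head-≡ x y∈) (λ _ → Unique.map⁺ (λ { refl → refl }) (words-unique m k)) (range-unique k)
    where
    head-≡ : ∀ x {y} → y ∈ map (x ∷_) (words m k) → nth y 0 ≡ x
    head-≡ x y∈ with _ , _ , refl ← ∈-map⁻ (x ∷_) y∈ = refl

  -- Occurrence counts take the place of injectivity because they are what the insertion of a single
  -- value changes in a controlled way.
  record IsPerm (N : ℕ) (σ : List ℕ) : Set where
    constructor mkPerm
    field
      length≡ : length σ ≡ N
      within  : All (Within N) σ
      once    : ∀ {v} → Within N v → occ v σ ≡ 1

  nth-∈ : ∀ σ {i} → i < length σ → nth σ i ∈ σ
  nth-∈ (x ∷ σ) {zero}  _        = here refl
  nth-∈ (x ∷ σ) {suc i} (s≤s i<) = there (nth-∈ σ i<)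

  ∈⇒nth : ∀ {σ v} → v ∈ σ → ∃ λ i → i < length σ × nth σ i ≡ v
  ∈⇒nth (here refl) = 0 , s≤s z≤n , refl
  ∈⇒nth (there v∈)  = let i , i< , e = ∈⇒nth v∈ in suc i , s≤s i< , e

  nth-++ : ∀ u y x → nth (u ++ y ∷ x) (length u) ≡ y
  nth-++ []      y x = refl
  nth-++ (_ ∷ u) y x = nth-++ u y x

  occ≤1⇒nth-injective : ∀ σ {v i j} → occ v σ ≤ 1 → i < length σ → j < length σ →
                        nth σ i ≡ v → nth σ j ≡ v → i ≡ j
  occ≤1⇒nth-injective (x ∷ σ) {i = zero}  {zero}  o i< j< p q = refl
  occ≤1⇒nth-injective (x ∷ σ) {i = zero}  {suc j} o i< (s≤s j<) refl q =
    ⊥-elim (<⇒≱ (∈⇒occ>0 (subst (_∈ σ) q (nth-∈ σ j<))) (s≤s⁻¹ (subst (_≤ 1) (occ-∷-≡ x σ) o)))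
  occ≤1⇒nth-injective (x ∷ σ) {i = suc i} {zero}  o (s≤s i<) j< q refl =
    ⊥-elim (<⇒≱ (∈⇒occ>0 (subst (_∈ σ) q (nth-∈ σ i<))) (s≤s⁻¹ (subst (_≤ 1) (occ-∷-≡ x σ) o)))
  occ≤1⇒nth-injective (x ∷ σ) {i = suc i} {suc j} o (s≤s i<) (s≤s j<) p q =
    cong suc (occ≤1⇒nth-injective σ (≤-trans (m≤n+m _ _) o) i< j< p q)

  NthInjective : List ℕ → Set
  NthInjective σ = ∀ {i j} → i < length σ → j < length σ → nth σ i ≡ nth σ j → i ≡ j

  nth-injective⇒occ≤1 : ∀ σ → NthInjective σ → ∀ v → occ v σ ≤ 1
  nth-injective⇒occ≤1 []      inj v = z≤n
  nth-injective⇒occ≤1 (x ∷ σ) inj v with x ≟ v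
  ... | no x≢v = subst (_≤ 1) (sym (occ-∷-≢ σ x≢v))
          (nth-injective⇒occ≤1 σ (λ i< j< e → suc-injective (inj (s≤s i<) (s≤s j<) e)) v)
  ... | yes refl = subst (_≤ 1) (sym (trans (occ-∷-≡ x σ) (cong suc (∉⇒occ≡0 (All.tabulate fresh))))) ≤-refl
    where
    fresh : ∀ {y} → y ∈ σ → y ≢ x
    fresh y∈ refl with i , i< , e ← ∈⇒nth y∈ with () ← inj (s≤s z≤n) (s≤s i<) (sym e)

  ∑-≤-length : {A : Set} (xs : List A) {f : A → ℕ} → (∀ x → f x ≤ 1) → ∑ xs f ≤ length xs
  ∑-≤-length []       h = z≤n
  ∑-≤-length (x ∷ xs) h = +-mono-≤ (h x) (∑-≤-length xs h)

  ∑≡length⇒≡1 : {A : Set} (xs : List A) {f : A → ℕ} → (∀ x → f x ≤ 1) → ∑ xs f ≡ length xs →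
                ∀ {x} → x ∈ xs → f x ≡ 1
  ∑≡length⇒≡1 (x ∷ xs) {f} h e x∈ with f x in fx | h x | x∈
  ... | zero     | _ | _         = ⊥-elim (<⇒≱ (≤-reflexive (sym e)) (∑-≤-length xs h))
  ... | suc zero | _ | here refl = fx
  ... | suc zero | _ | there x∈′ = ∑≡length⇒≡1 xs h (suc-injective e) x∈′
  ... | suc (suc _) | s≤s () | _

  ∑-const-1 : {A : Set} (xs : List A) → ∑ xs (λ _ → 1) ≡ length xs
  ∑-const-1 []       = refl
  ∑-const-1 (x ∷ xs) = cong suc (∑-const-1 xs)

  -- Double counting: the occurrences of the N possible values add up to the length N and are at
  -- most 1 each, so each of them is 1.
  injective⇒perm : ∀ {N σ} → length σ ≡ N → All (Within N) σ → NthInjective σ → IsPerm N σ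
  injective⇒perm {N} {σ} len wi inj = mkPerm len wi λ {v} (v≥1 , v≤N) →
    ∑≡length⇒≡1 (range N) {λ v → occ v σ} (nth-injective⇒occ≤1 σ inj) total (∈-range⁺ v≥1 v≤N)
    where
    open ≡-Reasoning
    hit : ∀ {x} → x ∈ σ → ∑ (range N) (λ v → ⟦ x ≡ᵇ v ⟧) ≡ 1
    hit {x} x∈ with x≥1 , x≤N ← All.lookup wi x∈ =
      trans (∑-range-single {f = λ v → ⟦ x ≡ᵇ v ⟧} (∈-range⁺ x≥1 x≤N) (λ _ q≢ → cong ⟦_⟧ (≡ᵇ-false (q≢ ∘ sym))))
            (cong ⟦_⟧ (≡ᵇ-refl x))
    total : ∑ (range N) (λ v → occ v σ) ≡ length (range N)
    total = begin
      ∑ (range N) (λ v → occ v σ)                ≡⟨ ∑-swap (range N) σ (λ v x → ⟦ x ≡ᵇ v ⟧) ⟩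
      ∑ σ (λ x → ∑ (range N) (λ v → ⟦ x ≡ᵇ v ⟧)) ≡⟨ ∑-cong σ hit ⟩
      ∑ σ (λ _ → 1)                              ≡⟨ ∑-const-1 σ ⟩
      length σ                                   ≡⟨ len ⟩
      N                                          ≡⟨ sym (trans (length-map suc (upTo N)) (length-upTo N)) ⟩
      length (range N)                           ∎

  findFirst-unique : ∀ (p : ℕ → Bool) {xs x} → x ∈ xs → p x ≡ true → (∀ {y} → y ∈ xs → p y ≡ true → y ≡ x) →
                     findFirst p xs ≡ x
  findFirst-unique p {y ∷ xs} x∈ px h with p y in eq | x∈
  ... | true  | _         = h (here refl) eq
  ... | false | here refl with () ← trans (sym eq) px
  ... | false | there x∈′ = findFirst-unique p x∈′ px (h ∘ there)

  module Permutation {N : ℕ} {σ : List ℕ} (π : IsPerm N σ) where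
    open IsPerm π

    private
      index : ∀ {i} → i ∈ range N → ∃ λ j → i ≡ suc j × j < length σ
      index i∈ with _ , j∈ , refl ← ∈-map⁻ suc i∈ = _ , refl , subst (_ <_) (sym length≡) (∈-upTo⁻ j∈)

    app-∈ : ∀ {i} → i ∈ range N → app σ i ∈ range N
    app-∈ i∈ with j , refl , j< ← index i∈ =
      let v≥1 , v≤N = All.lookup within (nth-∈ σ j<) in ∈-range⁺ v≥1 v≤N

    app-injective : ∀ {i j} → i ∈ range N → j ∈ range N → app σ i ≡ app σ j → i ≡ j
    app-injective {i} i∈ j∈ e with v∈ ← app-∈ i∈ with i′ , refl , i< ← index i∈ with j′ , refl , j< ← index j∈ =
      cong suc (occ≤1⇒nth-injective σ (≤-reflexive (once (∈-range⁻ v∈))) i< j< refl (sym e))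

    inv-unique : ∀ {i} → i ∈ range N → inv N σ (app σ i) ≡ i
    inv-unique {i} i∈ = findFirst-unique (λ p → app σ p ≡ᵇ app σ i) i∈ (≡ᵇ-refl (app σ i))
      (λ j∈ e → app-injective j∈ i∈ (≡ᵇ-true⁻ e))

    preimage : ∀ {v} → v ∈ range N → ∃ λ i → i ∈ range N × app σ i ≡ v
    preimage v∈ with ys , zs , refl ← occ-split _ σ (once (∈-range⁻ v∈)) =
      suc (length ys) , ∈-range⁺ (s≤s z≤n) (subst (suc (length ys) ≤_) length≡ ≤len) , nth-++ ys _ zs
      where
      ≤len : suc (length ys) ≤ length (ys ++ _ ∷ zs)
      ≤len = ≤-trans (+-monoʳ-≤ 1 (m≤m+n _ _)) (≤-reflexive (trans (sym (+-suc _ _)) (sym (length-++ ys))))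

    inv-∈ : ∀ {v} → v ∈ range N → inv N σ v ∈ range N
    inv-∈ v∈ with i , i∈ , refl ← preimage v∈ = subst (_∈ range N) (sym (inv-unique i∈)) i∈

    app-inv : ∀ {v} → v ∈ range N → app σ (inv N σ v) ≡ v
    app-inv v∈ with i , i∈ , refl ← preimage v∈ = cong (app σ) (inv-unique i∈)

  perms : ℕ → List (List ℕ)
  perms N = boolFilter (isPerm N) (words N N)

  ∈-perms⁻ : ∀ {N σ} → σ ∈ perms N → IsPerm N σ
  ∈-perms⁻ {N} {σ} σ∈ with w∈ , ip ← ∈-boolFilter⁻ (isPerm N) σ∈ with len , wi ← ∈-words⁻ N w∈ =
    injective⇒perm len wi inj
    where
    at : ∀ {i} → i < length σ → suc i ∈ range N
    at i< = ∈-range⁺ (s≤s z≤n) (subst (_ ≤_) len i<)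
    inj : NthInjective σ
    inj {i} {j} i< j< e with iff ← allB⁻ _ (allB⁻ _ ip (at i<)) (at j<)
      rewrite trans (cong (nth σ i ≡ᵇ_) (sym e)) (≡ᵇ-refl (nth σ i)) = ≡ᵇ-true⁻ iff

  ∈-perms⁺ : ∀ {N σ} → IsPerm N σ → σ ∈ perms N
  ∈-perms⁺ {N} {σ} π = ∈-boolFilter⁺ (isPerm N) (subst (λ m → σ ∈ words m N) length≡ (∈-words⁺ within))
    (allB⁺ _ (range N) λ i∈ → allB⁺ _ (range N) λ j∈ → test i∈ j∈)
    where
    open IsPerm π
    open Permutation π
    test : ∀ {i j} → i ∈ range N → j ∈ range N → (if app σ i ≡ᵇ app σ j then i ≡ᵇ j else true) ≡ true
    test {i} {j} i∈ j∈ with app σ i ≡ᵇ app σ j in e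
    ... | false = refl
    ... | true  with refl ← app-injective i∈ j∈ (≡ᵇ-true⁻ e) = ≡ᵇ-refl i

  perms-unique : ∀ N → Unique (perms N)
  perms-unique N = boolFilter-unique (isPerm N) (words-unique N N)

  unique⇒↭ : {A : Set} {xs ys : List A} → Unique xs → Unique ys →
             (∀ {x} → x ∈ xs → x ∈ ys) → (∀ {x} → x ∈ ys → x ∈ xs) → xs ↭ ys
  unique⇒↭ u v to from = ∼bag⇒↭ (unique∧set⇒bag u v (mk⇔ to from))

  -- The inverse permutation.

  inverse : ℕ → List ℕ → List ℕ
  inverse N σ = map (inv N σ) (range N)

  nth-map-range : ∀ (f : ℕ → ℕ) {N i} → i < N → nth (map f (range N)) i ≡ f (suc i)
  nth-map-range f {N} = go id N
    where
    go : ∀ (g : ℕ → ℕ) N {i} → i < N → nth (map f (map suc (applyUpTo g N))) i ≡ f (suc (g i))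
    go g (suc N) {zero}  _        = refl
    go g (suc N) {suc i} (s≤s i<) = go (g ∘ suc) N i<

  app-map-range : ∀ (f : ℕ → ℕ) {N i} → i ∈ range N → app (map f (range N)) i ≡ f i
  app-map-range f i∈ with _ , j∈ , refl ← ∈-map⁻ suc i∈ = nth-map-range f (∈-upTo⁻ j∈)

  map-app-range : ∀ σ → map (app σ) (range (length σ)) ≡ σ
  map-app-range σ = go σ id (λ _ → refl)
    where
    go : ∀ τ (g : ℕ → ℕ) → (∀ i → nth σ (g i) ≡ nth τ i) → map (app σ) (map suc (applyUpTo g (length τ))) ≡ τ
    go []      g h = refl
    go (x ∷ τ) g h = cong₂ _∷_ (h 0) (go τ (g ∘ suc) (h ∘ suc))

  module Inverse {N : ℕ} {σ : List ℕ} (π : IsPerm N σ) where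
    open IsPerm π
    open Permutation π

    app-inverse : ∀ {i} → i ∈ range N → app (inverse N σ) i ≡ inv N σ i
    app-inverse = app-map-range (inv N σ)

    inverse-perm : IsPerm N (inverse N σ)
    inverse-perm = injective⇒perm len (All.map⁺ (All.tabulate (∈-range⁻ ∘ inv-∈))) inj
      where
      len : length (inverse N σ) ≡ N
      len = trans (length-map _ (range N)) (trans (length-map suc (upTo N)) (length-upTo N))
      inj : NthInjective (inverse N σ)
      inj {i} {j} i< j< e = suc-injective (begin
        suc i                      ≡⟨ sym (app-inv i∈) ⟩
        app σ (inv N σ (suc i))    ≡⟨ cong (app σ) (trans (sym (app-inverse i∈)) (trans e (app-inverse j∈))) ⟩
        app σ (inv N σ (suc j))    ≡⟨ app-inv j∈ ⟩
        suc j                      ∎)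
        where
        open ≡-Reasoning
        i∈ = ∈-range⁺ (s≤s z≤n) (subst (_ ≤_) len i<)
        j∈ = ∈-range⁺ (s≤s z≤n) (subst (_ ≤_) len j<)

    inv-inverse : ∀ {i} → i ∈ range N → inv N (inverse N σ) i ≡ app σ i
    inv-inverse {i} i∈ = begin
      inv N (inverse N σ) i
        ≡⟨ cong (inv N (inverse N σ)) (sym (trans (app-inverse (app-∈ i∈)) (inv-unique i∈))) ⟩
      inv N (inverse N σ) (app (inverse N σ) (app σ i))
        ≡⟨ Permutation.inv-unique inverse-perm (app-∈ i∈) ⟩
      app σ i ∎
      where open ≡-Reasoning

    inverse-involutive : inverse N (inverse N σ) ≡ σ
    inverse-involutive = trans (map-cong-local (All.tabulate inv-inverse))
      (trans (cong (λ n → map (app σ) (range n)) (sym length≡)) (map-app-range σ))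

  perms↭inverse : ∀ N → map (inverse N) (perms N) ↭ perms N
  perms↭inverse N = unique⇒↭
    (map-unique (inverse N) (inverse N) (λ σ∈ → Inverse.inverse-involutive (∈-perms⁻ {N} σ∈)) (perms-unique N))
    (perms-unique N) to from
    where
    to : ∀ {σ} → σ ∈ map (inverse N) (perms N) → σ ∈ perms N
    to σ∈ with τ , τ∈ , refl ← ∈-map⁻ (inverse N) σ∈ = ∈-perms⁺ (Inverse.inverse-perm (∈-perms⁻ {N} τ∈))
    from : ∀ {σ} → σ ∈ perms N → σ ∈ map (inverse N) (perms N)
    from σ∈ = subst (_∈ map (inverse N) (perms N)) (Inverse.inverse-involutive (∈-perms⁻ {N} σ∈))
      (∈-map⁺ (inverse N) (∈-perms⁺ (Inverse.inverse-perm (∈-perms⁻ {N} σ∈))))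

  -- The statistics of k as counts over blocks of the word.

  ∑ᵢ : (ℕ → ℕ → ℕ) → List ℕ → ℕ
  ∑ᵢ g []       = 0
  ∑ᵢ g (x ∷ xs) = g 0 x + ∑ᵢ (g ∘ suc) xs

  ∑ᵢ-0 : ∀ g xs → (∀ i x → g i x ≡ 0) → ∑ᵢ g xs ≡ 0
  ∑ᵢ-0 g []       h = refl
  ∑ᵢ-0 g (x ∷ xs) h = cong₂ _+_ (h 0 x) (∑ᵢ-0 (g ∘ suc) xs (h ∘ suc))

  ∑-range≡∑ᵢ : ∀ (f : ℕ → ℕ → ℕ) σ → ∑ (range (length σ)) (λ j → f j (app σ j)) ≡ ∑ᵢ (f ∘ suc) σ
  ∑-range≡∑ᵢ f σ = trans (∑-map suc (upTo (length σ)) _) (go (f ∘ suc) σ)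
    where
    go : ∀ g σ → ∑ (upTo (length σ)) (λ i → g i (nth σ i)) ≡ ∑ᵢ g σ
    go g []      = refl
    go g (x ∷ σ) = trans (∑-upTo-suc (length σ) _) (cong (g 0 x +_) (go (g ∘ suc) σ))

  -- The bounds are put in 0-based form, with `suc i` in the first one, so that removing a letter of
  -- `xs` lowers both sides of each comparison and that clause holds by computation.
  ∑ᵢ-window : ∀ (q : ℕ → Bool) xs ys zs →
    ∑ᵢ (λ i v → ⟦ (length xs <ᵇ suc i) ∧ (i <ᵇ length xs + length ys) ∧ q v ⟧) (xs ++ ys ++ zs) ≡ count q ys
  ∑ᵢ-window q []       []       zs = ∑ᵢ-0 _ zs (λ _ _ → refl)
  ∑ᵢ-window q []       (y ∷ ys) zs = cong (⟦ q y ⟧ +_) (∑ᵢ-window q [] ys zs)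
  ∑ᵢ-window q (x ∷ xs) ys       zs = ∑ᵢ-window q xs ys zs

  -- Here `lo` is the last position before the block `ys` and `hi` the first one after it. All
  -- crossing and nesting numbers are brought to this form.
  window : ∀ {N σ lo hi} (q : ℕ → Bool) xs ys zs → length σ ≡ N → σ ≡ xs ++ ys ++ zs →
           lo ≡ length xs → hi ≡ suc (length xs + length ys) →
           ∑ (range N) (λ j → ⟦ (lo <ᵇ j) ∧ (j <ᵇ hi) ∧ q (app σ j) ⟧) ≡ count q ys
  window q xs ys zs refl refl refl refl =
    trans (∑-range≡∑ᵢ (λ j v → ⟦ (length xs <ᵇ j) ∧ (j <ᵇ suc (length xs + length ys)) ∧ q v ⟧) (xs ++ ys ++ zs))
          (∑ᵢ-window q xs ys zs)

  countB-triples : ∀ N (p : ℕ × ℕ × ℕ → Bool) →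
    countB p (triples N) ≡ ∑ (range N) (λ x → ∑ (range N) (λ y → ∑ (range N) (λ z → ⟦ p (x , y , z) ⟧)))
  countB-triples N p = trans (countB≡count p (triples N))
    (trans (∑-concatMap _ (range N) _) (∑-cong (range N) λ _ →
      trans (∑-concatMap _ (range N) _) (∑-cong (range N) λ _ → ∑-map _ (range N) _)))

  if-both : ∀ {a b c} → b ≡ true → c ≡ true → ⟦ a ∧ b ∧ c ⟧ ≡ ⟦ a ⟧
  if-both {a} refl refl = cong ⟦_⟧ (∧-identityʳ a)

  unless₁ : ∀ {a b c} → b ≡ false → ⟦ a ∧ b ∧ c ⟧ ≡ 0
  unless₁ {a} refl = cong ⟦_⟧ (∧-zeroʳ a)

  unless₂ : ∀ {a b c} → c ≡ false → ⟦ a ∧ b ∧ c ⟧ ≡ 0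
  unless₂ {a} {b} refl = cong ⟦_⟧ (trans (cong (a ∧_) (∧-zeroʳ b)) (∧-zeroʳ a))

  module Statistics {N : ℕ} {σ : List ℕ} (π : IsPerm N σ) where
    open Permutation π
    open ≡-Reasoning

    module _ {k : ℕ} (k∈ : k ∈ range N) where

      private
        p = inv N σ k

        here-true : (k ≡ᵇ app σ p) ≡ true
        here-true = subst (λ v → (k ≡ᵇ v) ≡ true) (sym (app-inv k∈)) (≡ᵇ-refl k)

        elsewhere : ∀ {i} → i ∈ range N → i ≢ p → (k ≡ᵇ app σ i) ≡ false
        elsewhere i∈ i≢ = ≡ᵇ-false λ e → i≢ (trans (sym (inv-unique i∈)) (cong (inv N σ) (sym e)))

      -- Of the three indices, k = σ(i) fixes i as the preimage of k and l = σ(j) eliminates l. The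
      -- other three statistics collapse in the same way.
      ucross'≡ : ucross' N σ k ≡ ∑ (range N) (λ j → ⟦ lt4 p j k (app σ j) ⟧)
      ucross'≡ = begin
        ucross' N σ k
          ≡⟨ countB-triples N _ ⟩
        ∑ (range N) (λ i → ∑ (range N) (λ j → ∑ (range N) (λ l → ⟦ lt4 i j k l ∧ (k ≡ᵇ app σ i) ∧ (l ≡ᵇ app σ j) ⟧)))
          ≡⟨ ∑-range-single (inv-∈ k∈) (λ {i} i∈ i≢ → ∑-0 (range N) λ {j} _ → ∑-0 (range N) λ {l} _ →
               unless₁ {lt4 i j k l} (elsewhere i∈ i≢)) ⟩
        ∑ (range N) (λ j → ∑ (range N) (λ l → ⟦ lt4 p j k l ∧ (k ≡ᵇ app σ p) ∧ (l ≡ᵇ app σ j) ⟧))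
          ≡⟨ ∑-cong (range N) (λ {j} j∈ → trans
               (∑-range-single (app-∈ j∈) (λ {l} _ l≢ → unless₂ {lt4 p j k l} {k ≡ᵇ app σ p} (≡ᵇ-false l≢)))
               (if-both {lt4 p j k (app σ j)} here-true (≡ᵇ-refl (app σ j)))) ⟩
        ∑ (range N) (λ j → ⟦ lt4 p j k (app σ j) ⟧) ∎

      unest'≡ : unest' N σ k ≡ ∑ (range N) (λ i → ⟦ lt4 i p k (app σ i) ⟧)
      unest'≡ = begin
        unest' N σ k
          ≡⟨ countB-triples N _ ⟩
        ∑ (range N) (λ i → ∑ (range N) (λ j → ∑ (range N) (λ l → ⟦ lt4 i j k l ∧ (k ≡ᵇ app σ j) ∧ (l ≡ᵇ app σ i) ⟧)))
          ≡⟨ ∑-cong (range N) (λ {i} i∈ → trans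
               (∑-range-single (inv-∈ k∈) (λ {j} j∈ j≢ → ∑-0 (range N) λ {l} _ →
                 unless₁ {lt4 i j k l} (elsewhere j∈ j≢)))
               (trans (∑-range-single (app-∈ i∈) (λ {l} _ l≢ → unless₂ {lt4 i p k l} {k ≡ᵇ app σ p} (≡ᵇ-false l≢)))
                 (if-both {lt4 i p k (app σ i)} here-true (≡ᵇ-refl (app σ i))))) ⟩
        ∑ (range N) (λ i → ⟦ lt4 i p k (app σ i) ⟧) ∎

      lcross'≡ : lcross' N σ k ≡ ∑ (range N) (λ j → ⟦ lt4 (app σ j) k j p ⟧)
      lcross'≡ = begin
        lcross' N σ k
          ≡⟨ countB-triples N _ ⟩
        ∑ (range N) (λ i → ∑ (range N) (λ j → ∑ (range N) (λ l → ⟦ lt4 i k j l ∧ (i ≡ᵇ app σ j) ∧ (k ≡ᵇ app σ l) ⟧)))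
          ≡⟨ ∑-swap (range N) (range N) _ ⟩
        ∑ (range N) (λ j → ∑ (range N) (λ i → ∑ (range N) (λ l → ⟦ lt4 i k j l ∧ (i ≡ᵇ app σ j) ∧ (k ≡ᵇ app σ l) ⟧)))
          ≡⟨ ∑-cong (range N) (λ {j} j∈ → trans
               (∑-range-single (app-∈ j∈) (λ {i} _ i≢ → ∑-0 (range N) λ {l} _ →
                 unless₁ {lt4 i k j l} (≡ᵇ-false i≢)))
               (trans (∑-range-single (inv-∈ k∈) (λ {l} l∈ l≢ →
                   unless₂ {lt4 (app σ j) k j l} {app σ j ≡ᵇ app σ j} (elsewhere l∈ l≢)))
                 (if-both {lt4 (app σ j) k j p} (≡ᵇ-refl (app σ j)) here-true))) ⟩
        ∑ (range N) (λ j → ⟦ lt4 (app σ j) k j p ⟧) ∎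

      lnest'≡ : lnest' N σ k ≡ ∑ (range N) (λ l → ⟦ lt4 (app σ l) k p l ⟧)
      lnest'≡ = begin
        lnest' N σ k
          ≡⟨ countB-triples N _ ⟩
        ∑ (range N) (λ i → ∑ (range N) (λ j → ∑ (range N) (λ l → ⟦ lt4 i k j l ∧ (i ≡ᵇ app σ l) ∧ (k ≡ᵇ app σ j) ⟧)))
          ≡⟨ ∑-cong (range N) (λ {i} i∈ → ∑-range-single (inv-∈ k∈) (λ {j} j∈ j≢ → ∑-0 (range N) λ {l} _ →
                 unless₂ {lt4 i k j l} {i ≡ᵇ app σ l} (elsewhere j∈ j≢))) ⟩
        ∑ (range N) (λ i → ∑ (range N) (λ l → ⟦ lt4 i k p l ∧ (i ≡ᵇ app σ l) ∧ (k ≡ᵇ app σ p) ⟧))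
          ≡⟨ ∑-swap (range N) (range N) _ ⟩
        ∑ (range N) (λ l → ∑ (range N) (λ i → ⟦ lt4 i k p l ∧ (i ≡ᵇ app σ l) ∧ (k ≡ᵇ app σ p) ⟧))
          ≡⟨ ∑-cong (range N) (λ {l} l∈ → trans
               (∑-range-single (app-∈ l∈) (λ {i} _ i≢ → unless₁ {lt4 i k p l} (≡ᵇ-false i≢)))
               (if-both {lt4 (app σ l) k p l} (≡ᵇ-refl (app σ l)) here-true)) ⟩
        ∑ (range N) (λ l → ⟦ lt4 (app σ l) k p l ⟧) ∎

      -- The condition i < k < σ⁻¹(i) is reindexed by the position l of i: the indicator of i = σ(l)
      -- is inserted, the sums are exchanged and the other index is collapsed.
      psnest-inverse≡ : psnest N (inverse N σ) k ≡ ∑ (range N) (λ l → ⟦ (app σ l <ᵇ k) ∧ (k <ᵇ l) ⟧)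
      psnest-inverse≡ = begin
        psnest N (inverse N σ) k
          ≡⟨ countB≡count _ (range N) ⟩
        ∑ (range N) (λ i → ⟦ (i <ᵇ k) ∧ (k <ᵇ app (inverse N σ) i) ⟧)
          ≡⟨ ∑-cong (range N) (λ {i} i∈ → cong (λ l → ⟦ (i <ᵇ k) ∧ (k <ᵇ l) ⟧) (Inverse.app-inverse π i∈)) ⟩
        ∑ (range N) (λ i → ⟦ (i <ᵇ k) ∧ (k <ᵇ inv N σ i) ⟧)
          ≡⟨ ∑-cong (range N) (λ {i} i∈ → sym (trans
               (∑-range-single (inv-∈ i∈) (λ {l} l∈ l≢ → unless₂ {i <ᵇ k} {k <ᵇ l}
                 (≡ᵇ-false λ e → l≢ (trans (sym (inv-unique l∈)) (cong (inv N σ) (sym e))))))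
               (trans (cong (λ b → ⟦ (i <ᵇ k) ∧ (k <ᵇ inv N σ i) ∧ b ⟧)
                             (subst (λ v → (i ≡ᵇ v) ≡ true) (sym (app-inv i∈)) (≡ᵇ-refl i)))
                      (cong ⟦_⟧ (cong ((i <ᵇ k) ∧_) (∧-identityʳ _)))))) ⟩
        ∑ (range N) (λ i → ∑ (range N) (λ l → ⟦ (i <ᵇ k) ∧ (k <ᵇ l) ∧ (i ≡ᵇ app σ l) ⟧))
          ≡⟨ ∑-swap (range N) (range N) _ ⟩
        ∑ (range N) (λ l → ∑ (range N) (λ i → ⟦ (i <ᵇ k) ∧ (k <ᵇ l) ∧ (i ≡ᵇ app σ l) ⟧))
          ≡⟨ ∑-cong (range N) (λ {l} l∈ → trans
               (∑-range-single (app-∈ l∈) (λ {i} _ i≢ → unless₂ {i <ᵇ k} {k <ᵇ l} (≡ᵇ-false i≢)))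
               (trans (cong (λ b → ⟦ (app σ l <ᵇ k) ∧ (k <ᵇ l) ∧ b ⟧) (≡ᵇ-refl (app σ l)))
                      (cong ⟦_⟧ (cong ((app σ l <ᵇ k) ∧_) (∧-identityʳ _))))) ⟩
        ∑ (range N) (λ l → ⟦ (app σ l <ᵇ k) ∧ (k <ᵇ l) ⟧) ∎

  rotateˡ : ∀ a b c → a ∧ b ∧ c ≡ b ∧ c ∧ a
  rotateˡ a b c = trans (∧-comm a (b ∧ c)) (∧-assoc b c a)

  ∈-middle : ∀ {N} u k {x} → IsPerm N (u ++ k ∷ x) → suc (length u) ∈ range N
  ∈-middle u k {x} π = ∈-range⁺ (s≤s z≤n) (subst (suc (length u) ≤_) (trans (sym (length-++ u)) (IsPerm.length≡ π))
    (≤-trans (s≤s (m≤m+n _ _)) (≤-reflexive (sym (+-suc (length u) (length x))))))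

  inv-middle : ∀ {N} u k {x} → IsPerm N (u ++ k ∷ x) → inv N (u ++ k ∷ x) k ≡ suc (length u)
  inv-middle {N} u k {x} π =
    trans (cong (inv N (u ++ k ∷ x)) (sym (nth-++ u k x))) (Permutation.inv-unique π (∈-middle u k π))

  length-split : ∀ (u : List ℕ) y x → length (u ++ y ∷ x) ≡ length (u ++ y ∷ []) + length x
  length-split u y x = trans (cong length (sym (++-assoc u (y ∷ []) x))) (length-++ (u ++ y ∷ []))

  split-last : ∀ (u : List ℕ) y x → u ++ y ∷ x ≡ (u ++ y ∷ []) ++ x ++ []
  split-last u y x = trans (sym (++-assoc u (y ∷ []) x)) (cong ((u ++ y ∷ []) ++_) (sym (++-identityʳ x)))

  length-∷ʳ : ∀ (u : List ℕ) y → length (u ++ y ∷ []) ≡ suc (length u)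
  length-∷ʳ u y = trans (length-++ u) (+-comm (length u) 1)

  -- The case σ⁻¹(k) < k: `u₁` and `u₂` are the entries before and after the value k within the
  -- first k - 1 positions. An entry above k crosses the arc of k if it lies in `u₂` and nests it if
  -- it lies in `u₁`.
  record UpperArc (N : ℕ) (σ : List ℕ) (k y : ℕ) (u₁ u₂ : List ℕ) : Set where
    field
      k∈       : k ∈ range N
      inv<     : inv N σ k < k
      app≡     : app σ k ≡ y
      ucross'≡ : ucross' N σ k ≡ count (k <ᵇ_) u₂
      unest'≡  : unest' N σ k ≡ count (k <ᵇ_) u₁

  upperArc : ∀ {N σ k} u₁ u₂ y x → IsPerm N σ → σ ≡ (u₁ ++ k ∷ u₂) ++ y ∷ x →
             suc (length (u₁ ++ k ∷ u₂)) ≡ k → UpperArc N σ k y u₁ u₂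
  upperArc {N} {σ} {k} u₁ u₂ y x π refl k≡ = record
    { k∈ = k∈
    ; inv< = p<k
    ; app≡ = subst (λ j → app σ j ≡ y) k≡ (nth-++ u y x)
    ; ucross'≡ = trans (Statistics.ucross'≡ π k∈)
        (window (k <ᵇ_) (u₁ ++ k ∷ []) u₂ (y ∷ x) (IsPerm.length≡ π) assoc₁
          (trans p≡ (sym (length-∷ʳ u₁ k))) (trans (sym k≡) (cong suc (length-split u₁ k u₂))))
    ; unest'≡ = trans (Statistics.unest'≡ π k∈) (trans
        (∑-cong (range N) (λ {i} i∈ → cong ⟦_⟧ (drop-true i∈)))
        (window (k <ᵇ_) [] u₁ (k ∷ u₂ ++ y ∷ x) (IsPerm.length≡ π) assoc₀ refl p≡))
    }
    where
    u = u₁ ++ k ∷ u₂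
    assoc₀ : (u₁ ++ k ∷ u₂) ++ y ∷ x ≡ u₁ ++ k ∷ u₂ ++ y ∷ x
    assoc₀ = ++-assoc u₁ (k ∷ u₂) (y ∷ x)
    assoc₁ : (u₁ ++ k ∷ u₂) ++ y ∷ x ≡ (u₁ ++ k ∷ []) ++ u₂ ++ y ∷ x
    assoc₁ = trans assoc₀ (sym (++-assoc u₁ (k ∷ []) (u₂ ++ y ∷ x)))
    k∈ : k ∈ range N
    k∈ = subst (_∈ range N) k≡ (∈-middle u y π)
    p = inv N σ k
    p≡ : p ≡ suc (length u₁)
    p≡ = trans (cong (λ τ → inv N τ k) assoc₀) (inv-middle u₁ k (subst (IsPerm N) assoc₀ π))
    p<k : p < k
    p<k = subst (p <_) k≡ (s≤s (subst (_≤ length u) (sym p≡)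
      (≤-trans (s≤s (m≤m+n _ _)) (≤-reflexive (trans (sym (+-suc _ _)) (sym (length-++ u₁)))))))
    -- The true condition p < k is traded for the equally true 0 < i, the lower bound of a block
    -- that begins at position 1.
    drop-true : ∀ {i} → i ∈ range N → lt4 i p k (app σ i) ≡ (0 <ᵇ i) ∧ (i <ᵇ p) ∧ (k <ᵇ app σ i)
    drop-true {i} i∈ rewrite <ᵇ-true p<k | <ᵇ-true (proj₁ (∈-range⁻ i∈)) = refl

  -- The case σ⁻¹(k) > k: `x₁` lies between position k and the value k, `x₂` behind that value.
  -- Smaller entries in `x₁` cross the arc of k, those in `x₂` nest it.
  record LowerArc (N : ℕ) (σ : List ℕ) (k y : ℕ) (x₁ x₂ : List ℕ) : Set where
    field
      k∈       : k ∈ range N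
      inv>     : k < inv N σ k
      app≡     : app σ k ≡ y
      lcross'≡ : lcross' N σ k ≡ count (_<ᵇ k) x₁
      lnest'≡  : lnest' N σ k ≡ count (_<ᵇ k) x₂

  lowerArc : ∀ {N σ k} u y x₁ x₂ → IsPerm N σ → σ ≡ u ++ y ∷ x₁ ++ k ∷ x₂ →
             suc (length u) ≡ k → LowerArc N σ k y x₁ x₂
  lowerArc {N} {σ} {k} u y x₁ x₂ π refl k≡ = record
    { k∈ = k∈
    ; inv> = k<p
    ; app≡ = subst (λ j → app σ j ≡ y) k≡ (nth-++ u y (x₁ ++ k ∷ x₂))
    ; lcross'≡ = trans (Statistics.lcross'≡ π k∈) (trans
        (∑-cong (range N) (λ {j} _ → cong ⟦_⟧ (rotateˡ (app σ j <ᵇ k) (k <ᵇ j) (j <ᵇ p))))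
        (window (_<ᵇ k) (u ++ y ∷ []) x₁ (k ∷ x₂) (IsPerm.length≡ π) (sym (++-assoc u (y ∷ []) _))
            (sym (trans (length-∷ʳ u y) k≡))
            (trans p≡ (cong suc (length-split u y x₁)))))
    ; lnest'≡ = trans (Statistics.lnest'≡ π k∈) (trans
        (∑-cong (range N) (λ {l} l∈ → cong ⟦_⟧ (bring-true l∈)))
        (window (_<ᵇ k) (v ++ k ∷ []) x₂ [] (IsPerm.length≡ π) (trans assoc (split-last v k x₂))
            (trans p≡ (sym (length-∷ʳ v k)))
            (cong suc (trans (sym (IsPerm.length≡ π)) (trans (cong length assoc) (length-split v k x₂))))))
    }
    where
    v = u ++ y ∷ x₁
    assoc : u ++ y ∷ x₁ ++ k ∷ x₂ ≡ v ++ k ∷ x₂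
    assoc = sym (++-assoc u (y ∷ x₁) (k ∷ x₂))
    k∈ : k ∈ range N
    k∈ = subst (_∈ range N) k≡ (∈-middle u y π)
    p = inv N σ k
    p≡ : p ≡ suc (length v)
    p≡ = trans (cong (λ τ → inv N τ k) assoc) (inv-middle v k (subst (IsPerm N) assoc π))
    k<p : k < p
    k<p = subst (_< p) k≡ (subst (suc (length u) <_) (sym p≡)
      (s≤s (≤-trans (s≤s (m≤m+n _ _)) (≤-reflexive (trans (sym (+-suc _ _)) (sym (length-++ u)))))))
    bring-true : ∀ {l} → l ∈ range N → lt4 (app σ l) k p l ≡ (p <ᵇ l) ∧ (l <ᵇ suc N) ∧ (app σ l <ᵇ k)
    bring-true {l} l∈ rewrite <ᵇ-true k<p | <ᵇ-true (s≤s (proj₂ (∈-range⁻ l∈))) = ∧-comm (app σ l <ᵇ k) (p <ᵇ l)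

  -- For σ the nestings over k are seen to its left, as larger entries; for σ⁻¹ they are seen to its
  -- right, as smaller entries of σ.
  record FixedPoint (N : ℕ) (σ : List ℕ) (k : ℕ) (u x : List ℕ) : Set where
    field
      k∈      : k ∈ range N
      inv≡    : inv N σ k ≡ k
      app≡    : app σ k ≡ k
      psnest≡ : psnest N σ k ≡ count (k <ᵇ_) u
      psnest-inverse≡ : psnest N (inverse N σ) k ≡ count (_<ᵇ k) x

  fixedPoint : ∀ {N σ k} u x → IsPerm N σ → σ ≡ u ++ k ∷ x → suc (length u) ≡ k → FixedPoint N σ k u x
  fixedPoint {N} {σ} {k} u x π refl k≡ = record
    { k∈ = k∈
    ; inv≡ = trans (inv-middle u k π) k≡
    ; app≡ = subst (λ j → app σ j ≡ k) k≡ (nth-++ u k x)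
    ; psnest≡ = trans (countB≡count _ (range N)) (trans
        (∑-cong (range N) (λ {i} i∈ → cong (λ b → ⟦ b ∧ (i <ᵇ k) ∧ (k <ᵇ app σ i) ⟧)
          (sym (<ᵇ-true (proj₁ (∈-range⁻ i∈))))))
        (window (k <ᵇ_) [] u (k ∷ x) (IsPerm.length≡ π) refl refl (sym k≡)))
    ; psnest-inverse≡ = trans (Statistics.psnest-inverse≡ π k∈) (trans
        (∑-cong (range N) (λ {l} l∈ → cong ⟦_⟧ (bring-true l∈)))
        (window (_<ᵇ k) (u ++ k ∷ []) x [] (IsPerm.length≡ π) (split-last u k x)
            (trans (sym k≡) (sym (length-∷ʳ u k)))
            (cong suc (trans (sym (IsPerm.length≡ π)) (length-split u k x)))))
    }
    where
    k∈ : k ∈ range N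
    k∈ = subst (_∈ range N) k≡ (∈-middle u k π)
    bring-true : ∀ {l} → l ∈ range N → (app σ l <ᵇ k) ∧ (k <ᵇ l) ≡ (k <ᵇ l) ∧ (l <ᵇ suc N) ∧ (app σ l <ᵇ k)
    bring-true {l} l∈ rewrite <ᵇ-true (s≤s (proj₂ (∈-range⁻ l∈))) = ∧-comm (app σ l <ᵇ k) (k <ᵇ l)

  -- The insertion tree and its leaves.

  cut : ℕ → ℕ → ℕ
  cut i v = if v <ᵇ suc i then v else 0

  below : ℕ → List ℕ → List ℕ
  below i = boolFilter (_<ᵇ suc i)

  cut-≤ : ∀ {i v} → v ≤ i → cut i v ≡ v
  cut-≤ {i} {v} v≤i rewrite <ᵇ-true (s≤s v≤i) = refl

  cut-> : ∀ {i v} → i < v → cut i v ≡ 0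
  cut-> {i} {v} i<v rewrite <ᵇ-false {v} {suc i} i<v = refl

  below-≤ : ∀ {i v} xs → v ≤ i → below i (v ∷ xs) ≡ v ∷ below i xs
  below-≤ {i} {v} xs v≤i rewrite <ᵇ-true (s≤s v≤i) = refl

  below-> : ∀ {i v} xs → i < v → below i (v ∷ xs) ≡ below i xs
  below-> {i} {v} xs i<v rewrite <ᵇ-false {v} {suc i} i<v = refl

  below-++ : ∀ i xs ys → below i (xs ++ ys) ≡ below i xs ++ below i ys
  below-++ i []       ys = refl
  below-++ i (x ∷ xs) ys with x <ᵇ suc i
  ... | true  = cong (x ∷_) (below-++ i xs ys)
  ... | false = below-++ i xs ys

  below-id : ∀ {i xs} → All (_≤ i) xs → below i xs ≡ xs
  below-id []                     = refl
  below-id {xs = x ∷ xs} (p ∷ ps) = trans (below-≤ xs p) (cong (x ∷_) (below-id ps))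

  below-none : ∀ {i xs} → All (i <_) xs → below i xs ≡ []
  below-none []                     = refl
  below-none {xs = x ∷ xs} (p ∷ ps) = trans (below-> xs p) (below-none ps)

  cut-id : ∀ {i xs} → All (_≤ i) xs → map (cut i) xs ≡ xs
  cut-id ps = map-id-local (All.map cut-≤ ps)

  cut-cut : ∀ i v → cut i (cut (suc i) v) ≡ cut i v
  cut-cut i v with ≤-<-connex v (suc i)
  ... | inj₁ v≤ = cong (cut i) (cut-≤ v≤)
  ... | inj₂ v> = trans (cong (cut i) (cut-> v>)) (sym (cut-> (<-trans (n<1+n i) v>)))

  below-below : ∀ i xs → below i (below (suc i) xs) ≡ below i xs
  below-below i []       = refl
  below-below i (x ∷ xs) with ≤-<-connex x (suc i) | ≤-<-connex x i
  ... | inj₁ p | inj₁ q = trans (cong (below i) (below-≤ xs p))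
    (trans (below-≤ (below (suc i) xs) q) (trans (cong (x ∷_) (below-below i xs)) (sym (below-≤ xs q))))
  ... | inj₁ p | inj₂ q = trans (cong (below i) (below-≤ xs p))
    (trans (below-> (below (suc i) xs) q) (trans (below-below i xs) (sym (below-> xs q))))
  ... | inj₂ p | _      = trans (cong (below i) (below-> xs p))
    (trans (below-below i xs) (sym (below-> xs (<-trans (n<1+n i) p))))

  ≤∧≢⇒≤ : ∀ {v i} → v ≤ suc i → v ≢ suc i → v ≤ i
  ≤∧≢⇒≤ v≤ v≢ = s≤s⁻¹ (≤∧≢⇒< v≤ v≢)

  cut-suc : ∀ {i xs} → All (_≢ suc i) xs → map (cut (suc i)) xs ≡ map (cut i) xs
  cut-suc {i} ps = map-cong-local (All.map step ps)
    where
    step : ∀ {v} → v ≢ suc i → cut (suc i) v ≡ cut i v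
    step {v} v≢ with ≤-<-connex v (suc i)
    ... | inj₁ v≤ = trans (cut-≤ v≤) (sym (cut-≤ (≤∧≢⇒≤ v≤ v≢)))
    ... | inj₂ v> = trans (cut-> v>) (sym (cut-> (<-trans (n<1+n i) v>)))

  below-suc : ∀ {i xs} → All (_≢ suc i) xs → below (suc i) xs ≡ below i xs
  below-suc []                         = refl
  below-suc {i} {x ∷ xs} (x≢ ∷ ps) with ≤-<-connex x (suc i)
  ... | inj₁ x≤ = trans (below-≤ xs x≤) (trans (cong (x ∷_) (below-suc ps)) (sym (below-≤ xs (≤∧≢⇒≤ x≤ x≢))))
  ... | inj₂ x> = trans (below-> xs x>) (trans (below-suc ps) (sym (below-> xs (<-trans (n<1+n i) x>))))

  -- The values of a permutation start at 1, which leaves 0 free as the mark of an open value.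
  cut≡0⇒> : ∀ {i v} → 1 ≤ v → cut i v ≡ 0 → i < v
  cut≡0⇒> {i} {v} v≥1 e with ≤-<-connex v i
  ... | inj₂ v> = v>
  ... | inj₁ v≤ with refl ← trans (sym (cut-≤ v≤)) e with () ← v≥1

  cut≥1⇒≡ : ∀ {i v y} → 1 ≤ y → cut i v ≡ y → v ≡ y × v ≤ i
  cut≥1⇒≡ {i} {v} y≥1 e with ≤-<-connex v i
  ... | inj₁ v≤ = trans (sym (cut-≤ v≤)) e , v≤
  ... | inj₂ v> with refl ← trans (sym (cut-> v>)) e with () ← y≥1

  State : Set
  State = List ℕ × List ℕ

  -- What is known of σ after i steps: its first i values, those above i being replaced by 0,
  -- and the values up to i that are still to come, in their order of appearance.
  state : ℕ → List ℕ → State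
  state i σ = map (cut i) (take i σ) , below i (drop i σ)

  push : ℕ → List ℕ × List ℕ → List ℕ × List ℕ
  push y (xs , ys) = y ∷ xs , ys

  -- A place for the new value is stored as the two parts on its sides, since the counts in these
  -- parts become the crossing and nesting numbers of that value.
  zeros cuts : List ℕ → List (List ℕ × List ℕ)
  zeros []           = []
  zeros (zero  ∷ xs) = ([] , xs) ∷ map (push 0) (zeros xs)
  zeros (suc y ∷ xs) = map (push (suc y)) (zeros xs)
  cuts []       = ([] , []) ∷ []
  cuts (y ∷ xs) = ([] , y ∷ xs) ∷ map (push y) (cuts xs)

  plug : ℕ → List ℕ × List ℕ → List ℕ
  plug k (xs , ys) = xs ++ k ∷ ys

  -- Waiting values are kept in their order of appearance, so a position that takes one of them has
  -- to take the first.
  rows : State → List State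
  rows (w , [])    = (w ++ 0 ∷ [] , []) ∷ []
  rows (w , y ∷ L) = (w ++ 0 ∷ [] , y ∷ L) ∷ (w ++ y ∷ [] , L) ∷ []

  cols : ℕ → State → List State
  cols k (w , L) = map (λ z → plug k z , L) (zeros w) ++ map (λ z → w , plug k z) (cuts L)

  steps : ℕ → State → List State
  steps k s = concatMap (cols k) (rows s)

  -- Testing that nothing waits is enough at the end: by the balance in `Valid` no position is open
  -- either.
  leaves : ℕ → ℕ → State → List (List ℕ)
  leaves zero    i (w , [])    = w ∷ []
  leaves zero    i (w , _ ∷ _) = []
  leaves (suc m) i s           = concatMap (leaves m (suc i)) (steps (suc i) s)

  ∈-zeros⁻ : ∀ {w z} → z ∈ zeros w → w ≡ plug 0 z
  ∈-zeros⁻ {zero  ∷ w} (here refl) = refl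
  ∈-zeros⁻ {zero  ∷ w} (there z∈) with _ , z∈′ , refl ← ∈-map⁻ (push 0) z∈ = cong (0 ∷_) (∈-zeros⁻ z∈′)
  ∈-zeros⁻ {suc y ∷ w} z∈ with _ , z∈′ , refl ← ∈-map⁻ (push (suc y)) z∈ = cong (suc y ∷_) (∈-zeros⁻ z∈′)

  ∈-zeros⁺ : ∀ xs ys → (xs , ys) ∈ zeros (xs ++ 0 ∷ ys)
  ∈-zeros⁺ []           ys = here refl
  ∈-zeros⁺ (zero  ∷ xs) ys = there (∈-map⁺ (push 0) (∈-zeros⁺ xs ys))
  ∈-zeros⁺ (suc y ∷ xs) ys = ∈-map⁺ (push (suc y)) (∈-zeros⁺ xs ys)

  ∈-cuts⁻ : ∀ {L z} → z ∈ cuts L → L ≡ proj₁ z ++ proj₂ z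
  ∈-cuts⁻ {[]}    (here refl) = refl
  ∈-cuts⁻ {y ∷ L} (here refl) = refl
  ∈-cuts⁻ {y ∷ L} (there z∈) with _ , z∈′ , refl ← ∈-map⁻ (push y) z∈ = cong (y ∷_) (∈-cuts⁻ z∈′)

  ∈-cuts⁺ : ∀ xs ys → (xs , ys) ∈ cuts (xs ++ ys)
  ∈-cuts⁺ []       []       = here refl
  ∈-cuts⁺ []       (y ∷ ys) = here refl
  ∈-cuts⁺ (x ∷ xs) ys       = there (∈-map⁺ (push x) (∈-cuts⁺ xs ys))

  push-injective : ∀ {y z z′} → push y z ≡ push y z′ → z ≡ z′
  push-injective refl = refl

  []∉push : ∀ {y ys zs} → All (([] , ys) ≢_) (map (push y) zs)
  []∉push = All.map⁺ (All.universal (λ _ ()) _)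

  zeros-unique : ∀ w → Unique (zeros w)
  zeros-unique []          = []
  zeros-unique (zero  ∷ w) = []∉push ∷ Unique.map⁺ push-injective (zeros-unique w)
  zeros-unique (suc y ∷ w) = Unique.map⁺ push-injective (zeros-unique w)

  cuts-unique : ∀ L → Unique (cuts L)
  cuts-unique []      = [] ∷ []
  cuts-unique (y ∷ L) = []∉push ∷ Unique.map⁺ push-injective (cuts-unique L)

  -- Finds the place of an inserted value again, which shows that different places give different
  -- states.
  breakAt : ℕ → List ℕ → List ℕ × List ℕ
  breakAt k []       = [] , []
  breakAt k (x ∷ xs) = if x ≡ᵇ k then ([] , xs) else push x (breakAt k xs)

  breakAt-plug : ∀ {k} xs ys → All (_≢ k) xs → breakAt k (xs ++ k ∷ ys) ≡ (xs , ys)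
  breakAt-plug {k} []       ys []       rewrite ≡ᵇ-refl k = refl
  breakAt-plug {k} (x ∷ xs) ys (p ∷ ps) rewrite ≡ᵇ-false p = cong (push x) (breakAt-plug xs ys ps)

  data RowView (w L : List ℕ) : State → Set where
    open-row  : RowView w L (w ++ 0 ∷ [] , L)
    close-row : ∀ {y L′} → L ≡ y ∷ L′ → RowView w L (w ++ y ∷ [] , L′)

  ∈-rows⁻ : ∀ {w L s} → s ∈ rows (w , L) → RowView w L s
  ∈-rows⁻ {L = []}    (here refl)         = open-row
  ∈-rows⁻ {L = y ∷ L} (here refl)         = open-row
  ∈-rows⁻ {L = y ∷ L} (there (here refl)) = close-row refl

  data ColView (k : ℕ) : State → State → Set where
    close-col : ∀ {w₁ w₂ L} → ColView k (w₁ ++ 0 ∷ w₂ , L) (w₁ ++ k ∷ w₂ , L)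
    open-col  : ∀ {w L₁ L₂} → ColView k (w , L₁ ++ L₂) (w , L₁ ++ k ∷ L₂)

  ∈-cols⁻ : ∀ {k s s′} → s′ ∈ cols k s → ColView k s s′
  ∈-cols⁻ {k} {w , L} s′∈ with ∈-++⁻ (map (λ z → plug k z , L) (zeros w)) s′∈
  ... | inj₁ ∈z with _ , z∈ , refl ← ∈-map⁻ _ ∈z with refl ← ∈-zeros⁻ {w} z∈ = close-col
  ... | inj₂ ∈c with _ , z∈ , refl ← ∈-map⁻ _ ∈c with refl ← ∈-cuts⁻ {L} z∈ = open-col

  ∈-cols⁺ : ∀ {k s s′} → ColView k s s′ → s′ ∈ cols k s
  ∈-cols⁺ {k} (close-col {w₁} {w₂} {L}) = ∈-++⁺ˡ (∈-map⁺ (λ z → plug k z , L) (∈-zeros⁺ w₁ w₂))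
  ∈-cols⁺ {k} (open-col {w} {L₁} {L₂})  =
    ∈-++⁺ʳ (map (λ z → plug k z , L₁ ++ L₂) (zeros w)) (∈-map⁺ (λ z → w , plug k z) (∈-cuts⁺ L₁ L₂))

  -- d is 0 between two steps, and 1 inside a step, when position i + 1 has been treated
  -- but not yet the value i + 1.
  record Valid (n i d : ℕ) (s : State) : Set where
    constructor valid
    field
      len     : length (proj₁ s) ≡ n
      bound   : All (_≤ i) (proj₁ s)
      boundᴸ  : All (Within i) (proj₂ s)
      balance : occ 0 (proj₁ s) ≡ d + length (proj₂ s)
      once    : ∀ {v} → Within i v → occ v (proj₁ s) + occ v (proj₂ s) ≡ 1

  occ-plug : ∀ v x xs ys → occ v (xs ++ x ∷ ys) ≡ ⟦ x ≡ᵇ v ⟧ + occ v (xs ++ ys)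
  occ-plug v x []       ys = refl
  occ-plug v x (z ∷ xs) ys = trans (cong (⟦ z ≡ᵇ v ⟧ +_) (occ-plug v x xs ys)) (x∙yz≈y∙xz ⟦ z ≡ᵇ v ⟧ ⟦ x ≡ᵇ v ⟧ _)
    where open import Algebra.Properties.CommutativeSemigroup +-commutativeSemigroup using (x∙yz≈y∙xz)

  occ-plug-≡ : ∀ x xs ys → occ x (xs ++ x ∷ ys) ≡ suc (occ x (xs ++ ys))
  occ-plug-≡ x xs ys = trans (occ-plug x x xs ys) (cong (λ b → ⟦ b ⟧ + occ x (xs ++ ys)) (≡ᵇ-refl x))

  occ-plug-≢ : ∀ {v x} xs ys → x ≢ v → occ v (xs ++ x ∷ ys) ≡ occ v (xs ++ ys)
  occ-plug-≢ {v} {x} xs ys x≢v = trans (occ-plug v x xs ys) (cong (λ b → ⟦ b ⟧ + occ v (xs ++ ys)) (≡ᵇ-false x≢v))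

  occ-∷ʳ-≡ : ∀ v xs → occ v (xs ++ v ∷ []) ≡ suc (occ v xs)
  occ-∷ʳ-≡ v xs = trans (occ-plug-≡ v xs []) (cong (suc ∘ occ v) (++-identityʳ xs))

  occ-∷ʳ-≢ : ∀ {v x} xs → x ≢ v → occ v (xs ++ x ∷ []) ≡ occ v xs
  occ-∷ʳ-≢ {v} xs x≢v = trans (occ-plug-≢ xs [] x≢v) (cong (occ v) (++-identityʳ xs))

  1≤⇒≢0 : ∀ {v} → 1 ≤ v → v ≢ 0
  1≤⇒≢0 () refl

  -- Both choices give the open positions a surplus of one: either a 0 is added or a waiting value
  -- is used up.
  rows-valid : ∀ {i s s⁺} → Valid i i 0 s → s⁺ ∈ rows s → Valid (suc i) i 1 s⁺
  rows-valid {i} {w , L} (valid len bd bdᴸ bal on) s⁺∈ with ∈-rows⁻ {w} {L} s⁺∈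
  ... | open-row = valid (trans (length-++ w) (trans (+-comm (length w) 1) (cong suc len))) (All.++⁺ bd (z≤n ∷ [])) bdᴸ
          (trans (occ-∷ʳ-≡ 0 w) (cong suc bal))
          (λ {v} wi → trans (cong (_+ occ v L) (occ-∷ʳ-≢ w (1≤⇒≢0 (proj₁ wi) ∘ sym))) (on wi))
  ... | close-row {y} {L′} refl with yw ∷ bdᴸ′ ← bdᴸ =
    valid (trans (length-++ w) (trans (+-comm (length w) 1) (cong suc len))) (All.++⁺ bd (proj₂ yw ∷ [])) bdᴸ′
          (trans (occ-∷ʳ-≢ w (1≤⇒≢0 (proj₁ yw))) bal)
          (λ {v} wi → trans (cong (_+ occ v L′) (occ-++ v w (y ∷ [])))
            (trans (+-assoc (occ v w) _ _) (trans (cong (occ v w +_) (cong (_+ occ v L′) (+-identityʳ _))) (on wi))))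

  ≤⇒occ-suc≡0 : ∀ {i xs} → All (_≤ i) xs → occ (suc i) xs ≡ 0
  ≤⇒occ-suc≡0 ps = ∉⇒occ≡0 (All.map (λ v≤i v≡ → <⇒≢ (s≤s v≤i) v≡) ps)

  within-suc : ∀ {i v} → Within (suc i) v → v ≡ suc i ⊎ (Within i v × suc i ≢ v)
  within-suc {i} {v} (v≥1 , v≤) with v ≟ suc i
  ... | yes e = inj₁ e
  ... | no ne = inj₂ ((v≥1 , ≤∧≢⇒≤ v≤ ne) , ne ∘ sym)

  All-plug⁻ : ∀ {P : ℕ → Set} xs {x ys} → All P (xs ++ x ∷ ys) → All P (xs ++ ys)
  All-plug⁻ xs ps with p , _ ∷ q ← All.++⁻ xs ps = All.++⁺ p q

  All-plug⁺ : ∀ {P : ℕ → Set} xs {x ys} → P x → All P (xs ++ ys) → All P (xs ++ x ∷ ys)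
  All-plug⁺ xs px ps with p , q ← All.++⁻ xs ps = All.++⁺ p (px ∷ q)

  length-plug : ∀ (xs : List ℕ) {x ys} → length (xs ++ x ∷ ys) ≡ suc (length (xs ++ ys))
  length-plug []       = refl
  length-plug (_ ∷ xs) = cong suc (length-plug xs)

  -- The surplus disappears again: the value i + 1 either fills a 0 or joins the waiting values.
  cols-valid : ∀ {i s s′} → Valid (suc i) i 1 s → s′ ∈ cols (suc i) s → Valid (suc i) (suc i) 0 s′
  cols-valid {i} {s} (valid len bd bdᴸ bal on) s′∈ with ∈-cols⁻ {suc i} {s} s′∈
  ... | close-col {w₁} {w₂} {L} = valid
    (trans (length-plug w₁) (trans (sym (length-plug w₁)) len))
    (All-plug⁺ w₁ ≤-refl (All.map m≤n⇒m≤1+n rest))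
    (All.map (λ (a , b) → a , m≤n⇒m≤1+n b) bdᴸ)
    (trans (occ-plug-≢ w₁ w₂ (λ ())) (suc-injective (trans (sym (occ-plug-≡ 0 w₁ w₂)) bal)))
    new
    where
    rest = All-plug⁻ w₁ bd
    new : ∀ {v} → Within (suc i) v → occ v (w₁ ++ suc i ∷ w₂) + occ v L ≡ 1
    new {v} wi with within-suc wi
    ... | inj₁ refl = cong₂ _+_ (trans (occ-plug-≡ (suc i) w₁ w₂) (cong suc (≤⇒occ-suc≡0 rest)))
        (≤⇒occ-suc≡0 (All.map proj₂ bdᴸ))
    ... | inj₂ (wi′ , ne) = trans (cong (_+ occ v L)
        (trans (occ-plug-≢ w₁ w₂ ne) (sym (occ-plug-≢ w₁ w₂ (1≤⇒≢0 (proj₁ wi) ∘ sym))))) (on wi′)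
  ... | open-col {w} {L₁} {L₂} = valid
    len
    (All.map m≤n⇒m≤1+n bd)
    (All-plug⁺ L₁ (s≤s z≤n , ≤-refl) (All.map (λ (a , b) → a , m≤n⇒m≤1+n b) bdᴸ))
    (trans bal (sym (length-plug L₁)))
    new
    where
    new : ∀ {v} → Within (suc i) v → occ v w + occ v (L₁ ++ suc i ∷ L₂) ≡ 1
    new {v} wi with within-suc wi
    ... | inj₁ refl = cong₂ _+_ (≤⇒occ-suc≡0 bd)
        (trans (occ-plug-≡ (suc i) L₁ L₂) (cong suc (≤⇒occ-suc≡0 (All.map proj₂ bdᴸ))))
    ... | inj₂ (wi′ , ne) = trans (cong (occ v w +_) (occ-plug-≢ L₁ L₂ ne)) (on wi′)

  ∈-steps⁻ : ∀ {k s s′} → s′ ∈ steps k s → ∃ λ s⁺ → s⁺ ∈ rows s × s′ ∈ cols k s⁺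
  ∈-steps⁻ {k} {s} s′∈ = find (∈-concatMap⁻ (cols k) {xs = rows s} s′∈)

  steps-valid : ∀ {i s s′} → Valid i i 0 s → s′ ∈ steps (suc i) s → Valid (suc i) (suc i) 0 s′
  steps-valid {i} {s} V s′∈ with s⁺ , r , c ← ∈-steps⁻ {suc i} {s} s′∈ = cols-valid (rows-valid V r) c

  restrict : ℕ → State → State
  restrict i (w , L) = map (cut i) w , below i L

  -- Forgetting the value i + 1 undoes its insertion: in the word it turns back into a 0, among the
  -- waiting values it disappears. The intermediate state is thus determined by its successor.
  cols-restrict : ∀ {i s s′} → Valid (suc i) i 1 s → s′ ∈ cols (suc i) s → restrict i s′ ≡ s
  cols-restrict {i} {s} (valid _ bd bdᴸ _ _) s′∈ with ∈-cols⁻ {suc i} {s} s′∈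
  ... | close-col {w₁} {w₂} {L} with p , _ ∷ q ← All.++⁻ w₁ bd =
    cong₂ _,_
      (trans (map-++ (cut i) w₁ _) (cong₂ _++_ (cut-id p) (cong₂ _∷_ (cut-> (n<1+n i)) (cut-id q))))
      (below-id (All.map proj₂ bdᴸ))
  ... | open-col {w} {L₁} {L₂} with p , q ← All.++⁻ L₁ (All.map proj₂ bdᴸ) =
    cong₂ _,_ (cut-id bd) (trans (below-++ i L₁ _) (cong₂ _++_ (below-id p) (trans (below-> L₂ (n<1+n i)) (below-id q))))

  rows-unique : ∀ {i s} → Valid i i 0 s → Unique (rows s)
  rows-unique {s = w , []}    V = [] ∷ []
  rows-unique {s = w , y ∷ L} (valid _ _ ((y≥1 , _) ∷ _) _ _) =
    ((λ e → 1≤⇒≢0 y≥1 (sym (proj₂ (∷ʳ-injective w w (,-injectiveˡ e))))) ∷ []) ∷ [] ∷ []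

  ≤⇒≢suc : ∀ {i xs} → All (_≤ i) xs → All (_≢ suc i) xs
  ≤⇒≢suc = All.map (λ v≤i → <⇒≢ (s≤s v≤i))

  -- All values present are at most i, so the place of i + 1 can be recovered within each kind, and
  -- the two kinds differ in whether i + 1 occurs in the first component.
  cols-unique : ∀ {i s} → Valid (suc i) i 1 s → Unique (cols (suc i) s)
  cols-unique {i} {w , L} (valid _ bd bdᴸ _ _) = Unique.++⁺
    (map-unique _ (breakAt (suc i) ∘ proj₁) left (zeros-unique w))
    (map-unique _ (breakAt (suc i) ∘ proj₂) right (cuts-unique L)) disjoint
    where
    left : ∀ {z} → z ∈ zeros w → breakAt (suc i) (plug (suc i) z) ≡ z
    left z∈ with refl ← ∈-zeros⁻ {w} z∈ = breakAt-plug _ _ (≤⇒≢suc (proj₁ (All.++⁻ _ bd)))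
    right : ∀ {z} → z ∈ cuts L → breakAt (suc i) (plug (suc i) z) ≡ z
    right z∈ with refl ← ∈-cuts⁻ {L} z∈ = breakAt-plug _ _ (≤⇒≢suc (All.map proj₂ (proj₁ (All.++⁻ _ bdᴸ))))
    disjoint : ∀ {s} → s ∈ map (λ z → plug (suc i) z , L) (zeros w) × s ∈ map (λ z → w , plug (suc i) z) (cuts L) → ⊥
    disjoint (a , b) with (w₁ , w₂) , _ , refl ← ∈-map⁻ _ a with _ , _ , e ← ∈-map⁻ _ b =
      All.lookup (≤⇒≢suc bd) (subst (suc i ∈_) (,-injectiveˡ e) (∈-++⁺ʳ w₁ (here refl))) refl

  steps-unique : ∀ {i s} → Valid i i 0 s → Unique (steps (suc i) s)
  steps-unique {i} V = concatMap-unique (cols (suc i)) (restrict i)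
    (λ r∈ → cols-restrict (rows-valid V r∈)) (λ r∈ → cols-unique (rows-valid V r∈)) (rows-unique V)

  split : ∀ i (σ : List ℕ) → i < length σ → ∃ λ u → ∃ λ y → ∃ λ x → σ ≡ u ++ y ∷ x × length u ≡ i
  split zero    (y ∷ x) _        = [] , y , x , refl , refl
  split (suc i) (v ∷ σ) (s≤s i<) with u , y , x , e , l ← split i σ i< = v ∷ u , y , x , cong (v ∷_) e , cong suc l

  state-++ : ∀ u x → state (length u) (u ++ x) ≡ (map (cut (length u)) u , below (length u) x)
  state-++ u x = cong₂ _,_ (cong (map (cut (length u))) (take-++ u x)) (cong (below (length u)) (drop-++ u x))
    where
    take-++ : ∀ (u x : List ℕ) → take (length u) (u ++ x) ≡ u
    take-++ []      x = refl
    take-++ (y ∷ u) x = cong (y ∷_) (take-++ u x)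
    drop-++ : ∀ (u x : List ℕ) → drop (length u) (u ++ x) ≡ x
    drop-++ []      x = refl
    drop-++ (y ∷ u) x = drop-++ u x

  state-suc : ∀ u y x → let k = suc (length u) in
              state k (u ++ y ∷ x) ≡ (map (cut k) (u ++ y ∷ []) , below k x)
  state-suc u y x = subst₂ (λ k σ → state k σ ≡ (map (cut k) (u ++ y ∷ []) , below k x))
    (trans (length-++ u) (+-comm (length u) 1)) (++-assoc u (y ∷ []) x) (state-++ (u ++ y ∷ []) x)

  restrict-state : ∀ u y x → let i = length u in
    restrict i (state (suc i) (u ++ y ∷ x)) ≡ (map (cut i) u ++ cut i y ∷ [] , below i x)
  restrict-state u y x = trans (cong (restrict i) (state-suc u y x)) (cong₂ _,_
    (trans (sym (map-∘ (u ++ y ∷ []))) (trans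
      (map-cong-local (All.universal (cut-cut i) (u ++ y ∷ []))) (map-++ (cut i) u (y ∷ []))))
    (below-below i x))
    where i = length u

  module _ (N : ℕ) where

    private
      bound-length : ∀ {i m σ} → i + suc m ≡ N → IsPerm N σ → i < length σ
      bound-length {i} e π = subst (i <_) (trans e (sym (IsPerm.length≡ π))) (m<m+n i (s≤s z≤n))

      shift-suc′ : ∀ {i m} → i + suc m ≡ N → suc i + m ≡ N
      shift-suc′ {i} {m} e = trans (sym (+-suc i m)) e

    -- Restriction returns the intermediate state, and its last entry reveals the row: a 0 means σ(i
    -- + 1) > i and no waiting value was taken, anything else is the first waiting value.
    state-step⁻ : ∀ {i s s⁺ s′} σ → IsPerm N σ → i < length σ → Valid i i 0 s →
                  s⁺ ∈ rows s → s′ ∈ cols (suc i) s⁺ → state (suc i) σ ≡ s′ → state i σ ≡ s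
    state-step⁻ {i} {w , L} σ π i< V r c eq with split i σ i<
    ... | u , y , x , refl , refl = trans (state-++ u (y ∷ x)) (back (∈-rows⁻ {w} {L} r)
        (trans (sym (restrict-state u y x)) (trans (cong (restrict i) eq) (cols-restrict (rows-valid V r) c))))
      where
      y≥1 : 1 ≤ y
      y≥1 = proj₁ (All.lookup (IsPerm.within π) (∈-++⁺ʳ u (here refl)))
      back : ∀ {s⁺} → RowView w L s⁺ → (map (cut i) u ++ cut i y ∷ [] , below i x) ≡ s⁺ →
             (map (cut i) u , below i (y ∷ x)) ≡ (w , L)
      back open-row e with a , b ← ∷ʳ-injective (map (cut i) u) w (,-injectiveˡ e) =
        cong₂ _,_ a (trans (below-> x (cut≡0⇒> y≥1 b)) (,-injectiveʳ e))
      back (close-row {y′} refl) e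
        with a , b ← ∷ʳ-injective (map (cut i) u) w (,-injectiveˡ e)
        with refl , y≤i ← cut≥1⇒≡ {i} {y} (proj₁ (All.head (Valid.boundᴸ V))) b =
        cong₂ _,_ a (trans (below-≤ x y≤i) (cong (y ∷_) (,-injectiveʳ e)))

    -- The second conclusion keeps the subtrees of different nodes disjoint and later allows the
    -- weight of a step to be read off the node.
    leaves-spec : ∀ m {i s σ} → i + m ≡ N → Valid i i 0 s → σ ∈ leaves m i s → IsPerm N σ × state i σ ≡ s
    -- No value is waiting, so the balance excludes a 0 from `w` and all entries are at least 1.
    leaves-spec zero {i} {w , []} e (valid len bd _ bal on) (here refl) with refl ← trans (sym (+-identityʳ i)) e =
      mkPerm len (All.zipWith (λ (v≢0 , v≤i) → n≢0⇒n>0 v≢0 , v≤i) (occ≡0⇒∉ w bal , bd))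
        (λ {v} wi → trans (sym (+-identityʳ _)) (on wi)) ,
      subst (λ n → state n w ≡ (w , [])) len
        (trans (cong (state (length w)) (sym (++-identityʳ w)))
          (trans (state-++ w []) (cong (_, []) (cut-id (subst (λ n → All (_≤ n) w) (sym len) bd)))))
    leaves-spec (suc m) {i} {s} {σ} e V σ∈
      with s′ , s′∈ , σ∈′ ← find (∈-concatMap⁻ (leaves m (suc i)) {xs = steps (suc i) s} σ∈)
      with s⁺ , r , c ← ∈-steps⁻ {suc i} {s} s′∈ =
      let π , eq = leaves-spec m (shift-suc′ e) (cols-valid (rows-valid V r) c) σ∈′
      in π , state-step⁻ σ π (bound-length {i} {m} {σ} e π) V r c eq

    state∈rows : ∀ {i} u y x → 1 ≤ y → (map (cut i) (u ++ y ∷ []) , below i x) ∈ rows (map (cut i) u , below i (y ∷ x))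
    state∈rows {i} u y x y≥1 with ≤-<-connex y i
    ... | inj₁ y≤ rewrite below-≤ x y≤ | map-++ (cut i) u (y ∷ []) | cut-≤ y≤ = there (here refl)
    ... | inj₂ y> rewrite below-> x y> | map-++ (cut i) u (y ∷ []) | cut-> y> = first (below i x)
      where
      first : ∀ L → (map (cut i) u ++ 0 ∷ [] , L) ∈ rows (map (cut i) u , L)
      first []      = here refl
      first (_ ∷ _) = here refl

    -- The single occurrence of i + 1 decides: if it lies in `v` it fills an open position, if it
    -- lies in `x` it joins the waiting values.
    state∈cols : ∀ {i} v x → occ (suc i) v + occ (suc i) x ≡ 1 →
                 (map (cut (suc i)) v , below (suc i) x) ∈ cols (suc i) (map (cut i) v , below i x)
    state∈cols {i} v x o with occ (suc i) v in ev | occ (suc i) x in ex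
    ... | zero | suc zero
      with x₁ , x₂ , refl ← occ-split (suc i) x ex
      with p , q ← All.++⁻ x₁ (occ≡0⇒∉ (x₁ ++ x₂) (suc-injective (trans (sym (occ-plug-≡ (suc i) x₁ x₂)) ex)))
      rewrite cut-suc (occ≡0⇒∉ v ev) | below-++ (suc i) x₁ (suc i ∷ x₂) | below-≤ {suc i} {suc i} x₂ ≤-refl
        | below-suc p | below-suc q | below-++ i x₁ (suc i ∷ x₂) | below-> {i} {suc i} x₂ ≤-refl = ∈-cols⁺ open-col
    ... | suc zero | zero
      with v₁ , v₂ , refl ← occ-split (suc i) v ev
      with p , q ← All.++⁻ v₁ (occ≡0⇒∉ (v₁ ++ v₂) (suc-injective (trans (sym (occ-plug-≡ (suc i) v₁ v₂)) ev)))
      rewrite below-suc (occ≡0⇒∉ x ex) | map-++ (cut (suc i)) v₁ (suc i ∷ v₂) | cut-≤ {suc i} {suc i} ≤-refl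
        | cut-suc p | cut-suc q | map-++ (cut i) v₁ (suc i ∷ v₂) | cut-> {i} {suc i} ≤-refl = ∈-cols⁺ close-col

    -- The successive states of σ trace a branch of the tree that ends in σ itself.
    perm∈leaves : ∀ m {i σ} → i + m ≡ N → IsPerm N σ → σ ∈ leaves m i (state i σ)
    perm∈leaves zero {i} {σ} e π = subst (λ s → σ ∈ leaves 0 i s) (sym s≡) (here refl)
      where
      s≡ : state i σ ≡ (σ , [])
      s≡ = trans (cong₂ state (trans (sym (+-identityʳ i)) (trans e (sym (IsPerm.length≡ π)))) (sym (++-identityʳ σ)))
        (trans (state-++ σ []) (cong (_, []) (cut-id
          (subst (λ n → All (_≤ n) σ) (sym (IsPerm.length≡ π)) (All.map proj₂ (IsPerm.within π))))))
    perm∈leaves (suc m) {i} {σ} e π with u , y , x , refl , refl ← split i σ (bound-length {i} {m} {σ} e π) =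
      ∈-concatMap⁺ (leaves m (suc i)) {xs = steps (suc i) (state i σ)} (lose step (perm∈leaves m (shift-suc′ e) π))
      where
      y≥1 : 1 ≤ y
      y≥1 = proj₁ (All.lookup (IsPerm.within π) (∈-++⁺ʳ u (here refl)))
      o : occ (suc i) (u ++ y ∷ []) + occ (suc i) x ≡ 1
      o = trans (sym (occ-++ (suc i) (u ++ y ∷ []) x)) (trans (cong (occ (suc i)) (++-assoc u (y ∷ []) x))
            (IsPerm.once π (s≤s z≤n , subst (suc i ≤_) (IsPerm.length≡ π) (bound-length e π))))
      step : state (suc i) σ ∈ steps (suc i) (state i σ)
      step = subst₂ (λ s′ s → s′ ∈ steps (suc i) s) (sym (state-suc u y x)) (sym (state-++ u (y ∷ x)))
        (∈-concatMap⁺ (cols (suc i)) {xs = rows (map (cut i) u , below i (y ∷ x))}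
          (lose (state∈rows u y x y≥1) (state∈cols (u ++ y ∷ []) x o)))

    leaves-unique : ∀ m {i s} → i + m ≡ N → Valid i i 0 s → Unique (leaves m i s)
    leaves-unique zero    {s = w , []}    e V = [] ∷ []
    leaves-unique zero    {s = w , _ ∷ _} e V = []
    leaves-unique (suc m) {i} {s} e V = concatMap-unique (leaves m (suc i)) (state (suc i))
      (λ s∈ σ∈ → proj₂ (leaves-spec m (shift-suc′ e) (steps-valid V s∈) σ∈))
      (λ s∈ → leaves-unique m (shift-suc′ e) (steps-valid V s∈)) (steps-unique V)

  valid-empty : Valid 0 0 0 ([] , [])
  valid-empty = valid refl [] [] refl (λ (v≥1 , v≤0) → ⊥-elim (<⇒≱ v≥1 v≤0))

  perms↭leaves : ∀ N → perms N ↭ leaves N 0 ([] , [])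
  perms↭leaves N = unique⇒↭ (perms-unique N) (leaves-unique N N refl valid-empty)
    (λ {σ} σ∈ → let π = ∈-perms⁻ {N} σ∈ in
      subst (λ L → σ ∈ leaves N 0 ([] , L)) (below-none (All.map proj₁ (IsPerm.within π))) (perm∈leaves N N refl π))
    (λ σ∈ → ∈-perms⁺ (proj₁ (leaves-spec N N refl valid-empty σ∈)))

  -- Reading the blocks of a permutation off its state.

  map-≡-++-∷ : ∀ (f : ℕ → ℕ) u {w₁ c w₂} → map f u ≡ w₁ ++ c ∷ w₂ →
    ∃ λ u₁ → ∃ λ z → ∃ λ u₂ → u ≡ u₁ ++ z ∷ u₂ × map f u₁ ≡ w₁ × f z ≡ c × map f u₂ ≡ w₂
  map-≡-++-∷ f (z ∷ u) {[]}     e with a , b ← ∷-injective e = [] , z , u , refl , refl , a , b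
  map-≡-++-∷ f (z ∷ u) {x ∷ w₁} e with a , b ← ∷-injective e
    with u₁ , z′ , u₂ , refl , p , q , r ← map-≡-++-∷ f u b = z ∷ u₁ , z′ , u₂ , refl , cong₂ _∷_ a p , q , r

  below-≡-++-∷ : ∀ k x {L₁ c L₂} → below k x ≡ L₁ ++ c ∷ L₂ →
    ∃ λ x₁ → ∃ λ x₂ → x ≡ x₁ ++ c ∷ x₂ × below k x₁ ≡ L₁ × below k x₂ ≡ L₂
  below-≡-++-∷ k []      {[]}     ()
  below-≡-++-∷ k []      {_ ∷ _}  ()
  below-≡-++-∷ k (v ∷ x) {L₁} e with ≤-<-connex v k
  ... | inj₂ v> with x₁ , x₂ , refl , p , q ← below-≡-++-∷ k x (trans (sym (below-> x v>)) e) =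
    v ∷ x₁ , x₂ , refl , trans (below-> x₁ v>) p , q
  below-≡-++-∷ k (v ∷ x) {[]}     e | inj₁ v≤ with refl , b ← ∷-injective (trans (sym (below-≤ x v≤)) e) =
    [] , x , refl , refl , b
  below-≡-++-∷ k (v ∷ x) {y ∷ L₁} e | inj₁ v≤ with refl , b ← ∷-injective (trans (sym (below-≤ x v≤)) e)
    with x₁ , x₂ , refl , p , q ← below-≡-++-∷ k x b = v ∷ x₁ , x₂ , refl , trans (below-≤ x₁ v≤) (cong (v ∷_) p) , q

  count-above : ∀ {k u} → All (1 ≤_) u → count (k <ᵇ_) u ≡ occ 0 (map (cut k) u)
  count-above [] = refl
  count-above {k} {v ∷ u} (v≥1 ∷ ps) with ≤-<-connex v k
  ... | inj₁ v≤ rewrite <ᵇ-false v≤ | cut-≤ v≤ | ≡ᵇ-false (1≤⇒≢0 v≥1) = count-above ps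
  ... | inj₂ v> rewrite <ᵇ-true v> | cut-> v> = cong suc (count-above ps)

  -- The hypothesis excludes the value i + 1 itself from `x`, so the strict comparison of the
  -- statistics agrees with the weak one of `below`.
  count-below : ∀ {i} x → All (_≤ i) (below (suc i) x) → count (_<ᵇ suc i) x ≡ length (below (suc i) x)
  count-below []      ps = refl
  count-below {i} (v ∷ x) ps with ≤-<-connex v (suc i)
  ... | inj₂ v> rewrite <ᵇ-false (ℕ.<⇒≤ v>) =
    trans (count-below x (subst (All (_≤ i)) (below-> x v>) ps)) (cong length (sym (below-> x v>)))
  ... | inj₁ v≤ with v≤i ∷ ps′ ← subst (All (_≤ i)) (below-≤ x v≤) ps rewrite <ᵇ-true (s≤s v≤i) =
    trans (cong suc (count-below x ps′)) (cong length (sym (below-≤ x v≤)))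

  state-suc⁻ : ∀ {i s} σ → i < length σ → state (suc i) σ ≡ s →
    ∃ λ u → ∃ λ y → ∃ λ x → σ ≡ u ++ y ∷ x × length u ≡ i ×
      map (cut (suc i)) u ++ cut (suc i) y ∷ [] ≡ proj₁ s × below (suc i) x ≡ proj₂ s
  state-suc⁻ {i} σ i< refl with split i σ i<
  ... | u , y , x , refl , refl = u , y , x , refl , refl ,
    sym (trans (cong proj₁ (state-suc u y x)) (map-++ (cut (suc i)) u (y ∷ []))) , sym (cong proj₂ (state-suc u y x))

  segment : ℕ → ℕ → List ℕ
  segment i zero    = []
  segment i (suc m) = suc i ∷ segment (suc i) m

  range≡segment : ∀ N → range N ≡ segment 0 N
  range≡segment N = go id 0 N (λ _ → refl)
    where
    go : ∀ (g : ℕ → ℕ) i m → (∀ j → g j ≡ i ℕ.+ j) → map suc (applyUpTo g m) ≡ segment i m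
    go g i zero    h = refl
    go g i (suc m) h = cong₂ _∷_ (cong suc (trans (h 0) (+-identityʳ i)))
      (go (g ∘ suc) (suc i) m (λ j → trans (h (suc j)) (+-suc i j)))

  bool-ext : ∀ {b b′} → (b ≡ true → b′ ≡ true) → (b′ ≡ true → b ≡ true) → b ≡ b′
  bool-ext {false} {false} f g = refl
  bool-ext {false} {true}  f g = g refl
  bool-ext {true}  {false} f g = sym (f refl)
  bool-ext {true}  {true}  f g = refl

  -- Statistics of the inverse, and the defining condition of 𝔇₂ₙ index by index.

  module InverseStatistics {N : ℕ} {σ : List ℕ} (π : IsPerm N σ) where
    open Permutation π
    open Inverse π

    private
      τ = inverse N σ

      -- Each equation of a statistic is turned around while the triple and its order conditions
      -- stay fixed; for nestings the two equations also change places.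
      flip-≡ᵇ : ∀ {i j} → i ∈ range N → j ∈ range N → (j ≡ᵇ app τ i) ≡ (i ≡ᵇ app σ j)
      flip-≡ᵇ {i} {j} i∈ j∈ = trans (cong (j ≡ᵇ_) (app-inverse i∈)) (bool-ext
        (λ e → trans (cong (i ≡ᵇ_) (trans (cong (app σ) (≡ᵇ-true⁻ {j} {inv N σ i} e)) (app-inv i∈))) (≡ᵇ-refl i))
        (λ e → trans (cong (j ≡ᵇ_) (trans (cong (inv N σ) (≡ᵇ-true⁻ {i} {app σ j} e)) (inv-unique j∈))) (≡ᵇ-refl j)))

      countB-triples-cong : {p q : ℕ × ℕ × ℕ → Bool} →
        (∀ {x y z} → x ∈ range N → y ∈ range N → z ∈ range N → p (x , y , z) ≡ q (x , y , z)) →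
        countB p (triples N) ≡ countB q (triples N)
      countB-triples-cong {p} {q} h = trans (countB-triples N p) (trans
        (∑-cong (range N) λ x∈ → ∑-cong (range N) λ y∈ → ∑-cong (range N) λ z∈ → cong ⟦_⟧ (h x∈ y∈ z∈))
        (sym (countB-triples N q)))

    module _ {k : ℕ} (k∈ : k ∈ range N) where

      ucross-inverse : ucross N τ k ≡ lcross' N σ k
      ucross-inverse = countB-triples-cong λ {i} {j} {l} i∈ j∈ l∈ →
        cong₂ (λ b b′ → lt4 i k j l ∧ b ∧ b′) (flip-≡ᵇ i∈ j∈) (flip-≡ᵇ k∈ l∈)

      unest-inverse : unest N τ k ≡ lnest' N σ k
      unest-inverse = countB-triples-cong λ {i} {j} {l} i∈ j∈ l∈ → cong (lt4 i k j l ∧_)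
        (trans (∧-comm (j ≡ᵇ app τ k) _) (cong₂ _∧_ (flip-≡ᵇ i∈ l∈) (flip-≡ᵇ k∈ j∈)))

      lcross-inverse : lcross N τ k ≡ ucross' N σ k
      lcross-inverse = countB-triples-cong λ {i} {j} {l} i∈ j∈ l∈ →
        cong₂ (λ b b′ → lt4 i j k l ∧ b ∧ b′) (flip-≡ᵇ k∈ i∈) (flip-≡ᵇ l∈ j∈)

      lnest-inverse : lnest N τ k ≡ unest' N σ k
      lnest-inverse = countB-triples-cong λ {i} {j} {l} i∈ j∈ l∈ → cong (lt4 i j k l ∧_)
        (trans (∧-comm (i ≡ᵇ app τ l) _) (cong₂ _∧_ (flip-≡ᵇ k∈ j∈) (flip-≡ᵇ l∈ i∈)))

  2*≡double : ∀ n → 2 ℕ.* n ≡ double n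
  2*≡double zero    = refl
  2*≡double (suc n) = trans (*-suc 2 n) (cong (suc ∘ suc) (2*≡double n))

  admits : ℕ → ℕ → Bool
  admits k y = if isEven k then y ≤ᵇ' k else k ≤ᵇ' y

  isEven-double : ∀ n → isEven (double n) ≡ true
  isEven-double zero    = refl
  isEven-double (suc n) = cong (not ∘ not) (isEven-double n)

  ⌊double/2⌋ : ∀ n → ⌊ double n /2⌋ ≡ n
  ⌊double/2⌋ zero    = refl
  ⌊double/2⌋ (suc n) = cong suc (⌊double/2⌋ n)

  -- The condition on the pair (2k - 1, 2k) is separated into one per index, so that it can be
  -- absorbed by the factor of that index.
  isD≡allB : ∀ n σ → isD n σ ≡ allB (λ k → admits k (app σ k)) (range (2 ℕ.* n))
  isD≡allB n σ = trans (cong (allB _) (range≡segment n)) (trans (go 0 n)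
    (cong (allB _) (trans (cong (segment 0) (sym (2*≡double n))) (sym (range≡segment (2 ℕ.* n))))))
    where
    pair : ℕ → Bool
    pair j = ((j ∸ 1) ≤ᵇ' app σ (j ∸ 1)) ∧ (app σ j ≤ᵇ' j)
    unpair : ∀ i r → pair (double (suc i)) ∧ r ≡
             admits (suc (double i)) (app σ (suc (double i))) ∧ admits (double (suc i)) (app σ (double (suc i))) ∧ r
    unpair i r rewrite isEven-double i = ∧-assoc (suc (double i) ≤ᵇ' app σ (suc (double i))) _ r
    go : ∀ i m → allB (λ k → pair (2 ℕ.* k)) (segment i m) ≡
                 allB (λ k → admits k (app σ k)) (segment (double i) (double m))
    go i zero    = refl
    go i (suc m) = trans (cong₂ _∧_ (cong pair (2*≡double (suc i))) (go (suc i) m)) (unpair i _)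

open Combinatorics

-- Summation over the insertion tree.

module TreeSum {c ℓ : Level} (R : CommutativeSemiring c ℓ) where
  open ≡ using (refl; sym; trans)
  open CommutativeSemiring R renaming (refl to ≈-refl; sym to ≈-sym; trans to ≈-trans) hiding (zero)
  open Sums R
  open Paths R
  open import Relation.Binary.Reasoning.Setoid setoid

  -- The zero with ξ zeros before it has h - 1 - ξ behind it, h being the number of zeros: each pair
  -- of the diagonal sum arises once.
  ∑-zeros : ∀ (F : ℕ → ℕ → Carrier) w →
    ∑ (zeros w) (λ z → F (occ 0 (proj₂ z)) (occ 0 (proj₁ z))) ≈ diagSum R F (occ 0 w)
  ∑-zeros F w = go 0 w
    where
    -- `p` counts the zeros already passed.
    go : ∀ p w → ∑ (zeros w) (λ z → F (occ 0 (proj₂ z)) (p ℕ.+ occ 0 (proj₁ z))) ≈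
                 ∑ (upTo (occ 0 w)) (λ ξ → F (occ 0 w ∸ 1 ∸ ξ) (p ℕ.+ ξ))
    go p []          = ≈-refl
    go p (suc y ∷ w) = ≈-trans (reflexive (∑-map (push (suc y)) (zeros w) _)) (go p w)
    go p (zero  ∷ w) = begin
      F (occ 0 w) (p ℕ.+ 0) + ∑ (map (push 0) (zeros w)) (λ z → F (occ 0 (proj₂ z)) (p ℕ.+ occ 0 (proj₁ z)))
        ≈⟨ +-congˡ (≈-trans (reflexive (∑-map (push 0) (zeros w) _))
             (∑-cong (zeros w) (λ {z} _ → reflexive (cong (F (occ 0 (proj₂ z))) (+-suc p (occ 0 (proj₁ z))))))) ⟩
      F (occ 0 w) (p ℕ.+ 0) + ∑ (zeros w) (λ z → F (occ 0 (proj₂ z)) (suc p ℕ.+ occ 0 (proj₁ z)))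
        ≈⟨ +-congˡ (≈-trans (go (suc p) w) (∑-cong (upTo (occ 0 w)) (λ {ξ} _ →
             reflexive (cong₂ F (∸-+-assoc (occ 0 w) 1 ξ) (sym (+-suc p ξ)))))) ⟩
      F (occ 0 w) (p ℕ.+ 0) + ∑ (upTo (occ 0 w)) (λ ξ → F (occ 0 w ∸ suc ξ) (p ℕ.+ suc ξ))
        ≈⟨ reflexive (∑-upTo-suc (occ 0 w) (λ ξ → F (occ 0 w ∸ ξ) (p ℕ.+ ξ))) ⟨
      ∑ (upTo (suc (occ 0 w))) (λ ξ → F (occ 0 w ∸ ξ) (p ℕ.+ ξ)) ∎

  ∑-cuts : ∀ (F : ℕ → ℕ → Carrier) L →
    ∑ (cuts L) (λ z → F (length (proj₁ z)) (length (proj₂ z))) ≈ diagSum R F (suc (length L))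
  ∑-cuts F L = go 0 L
    where
    go : ∀ q L → ∑ (cuts L) (λ z → F (q ℕ.+ length (proj₁ z)) (length (proj₂ z))) ≈
                 ∑ (upTo (suc (length L))) (λ ξ → F (q ℕ.+ (length L ∸ ξ)) ξ)
    go q []      = ≈-refl
    go q (y ∷ L) = begin
      F (q ℕ.+ 0) (suc n) + ∑ (map (push y) (cuts L)) (λ z → F (q ℕ.+ length (proj₁ z)) (length (proj₂ z)))
        ≈⟨ +-congˡ (≈-trans (reflexive (∑-map (push y) (cuts L) _))
             (∑-cong (cuts L) (λ {z} _ → reflexive (cong (λ j → F j (length (proj₂ z))) (+-suc q (length (proj₁ z))))))) ⟩
      F (q ℕ.+ 0) (suc n) + ∑ (cuts L) (λ z → F (suc q ℕ.+ length (proj₁ z)) (length (proj₂ z)))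
        ≈⟨ +-cong (≈-trans (reflexive (cong (λ j → F (q ℕ.+ j) (suc n)) (sym (n∸n≡0 n)))) (≈-sym (+-identityʳ _)))
             (≈-trans (go (suc q) L) (∑-cong (upTo (suc n)) (λ {ξ} ξ∈ → reflexive (cong (λ j → F j ξ)
               (sym (trans (cong (q ℕ.+_) (+-∸-assoc 1 (s≤s⁻¹ (∈-upTo⁻ ξ∈)))) (+-suc q (n ∸ ξ)))))))) ⟩
      (F (q ℕ.+ (suc n ∸ suc n)) (suc n) + 0#) + ∑ (upTo (suc n)) (λ ξ → F (q ℕ.+ (suc n ∸ ξ)) ξ)
        -- `cuts` begins with the empty left part, whereas the diagonal sum runs over the length ξ
        -- of the right part: the first cut is its last term.
        ≈⟨ +-comm _ _ ⟩
      ∑ (upTo (suc n)) (λ ξ → F (q ℕ.+ (suc n ∸ ξ)) ξ) + ∑ (suc n ∷ []) (λ ξ → F (q ℕ.+ (suc n ∸ ξ)) ξ)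
        ≈⟨ ∑-++ (upTo (suc n)) (suc n ∷ []) _ ⟨
      ∑ (upTo (suc n) ++ suc n ∷ []) (λ ξ → F (q ℕ.+ (suc n ∸ ξ)) ξ)
        ≈⟨ reflexive (cong (λ xs → ∑ xs (λ ξ → F (q ℕ.+ (suc n ∸ ξ)) ξ)) (upTo-∷ʳ (suc n))) ⟩
      ∑ (upTo (suc (suc n))) (λ ξ → F (q ℕ.+ (suc n ∸ ξ)) ξ) ∎
      where
      n = length L

  -- The term split off fills the zero just created at position k with the value k: it will be the
  -- fixed point.
  ∑-zeros-∷ʳ0 : ∀ w (f : List ℕ × List ℕ → Carrier) →
    ∑ (zeros (w ++ 0 ∷ [])) f ≈ ∑ (zeros w) (λ z → f (proj₁ z , proj₂ z ++ 0 ∷ [])) + f (w , [])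
  ∑-zeros-∷ʳ0 []          f = +-comm _ _
  ∑-zeros-∷ʳ0 (zero  ∷ w) f = ≈-trans (+-congˡ (≈-trans (reflexive (∑-map (push 0) (zeros (w ++ 0 ∷ [])) f))
    (≈-trans (∑-zeros-∷ʳ0 w (f ∘ push 0)) (+-congʳ (reflexive (sym (∑-map (push 0) (zeros w) _))))))) (≈-sym (+-assoc _ _ _))
  ∑-zeros-∷ʳ0 (suc y ∷ w) f = ≈-trans (reflexive (∑-map (push (suc y)) (zeros (w ++ 0 ∷ [])) f))
    (≈-trans (∑-zeros-∷ʳ0 w (f ∘ push (suc y))) (+-congʳ (reflexive (sym (∑-map (push (suc y)) (zeros w) _)))))

  ∑-zeros-∷ʳ : ∀ w {y} (f : List ℕ × List ℕ → Carrier) → 1 ≤ y →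
    ∑ (zeros (w ++ y ∷ [])) f ≈ ∑ (zeros w) (λ z → f (proj₁ z , proj₂ z ++ y ∷ []))
  ∑-zeros-∷ʳ []          {suc y} f y≥1 = ≈-refl
  ∑-zeros-∷ʳ (zero  ∷ w) f y≥1 = +-congˡ (≈-trans (reflexive (∑-map (push 0) (zeros (w ++ _ ∷ [])) f))
    (≈-trans (∑-zeros-∷ʳ w (f ∘ push 0) y≥1) (reflexive (sym (∑-map (push 0) (zeros w) _)))))
  ∑-zeros-∷ʳ (suc z ∷ w) f y≥1 = ≈-trans (reflexive (∑-map (push (suc z)) (zeros (w ++ _ ∷ [])) f))
    (≈-trans (∑-zeros-∷ʳ w (f ∘ push (suc z)) y≥1) (reflexive (sym (∑-map (push (suc z)) (zeros w) _))))

  -- The common interface of both families: the factor at k depends only on the type of k and on the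
  -- counts on the two sides of its place, crossing number first. The premise of `fixed` on equal
  -- counts serves σ⁻¹, whose psnest is read on the right of k.
  record LocalWeights (N : ℕ) (ω : ℕ → List ℕ → Carrier)
                      (A B C D : ℕ → ℕ → ℕ → Carrier) (E : ℕ → ℕ → Carrier) : Set (c ⊔ ℓ) where
    field
      valley : ∀ {σ k} u y x₁ x₂ → IsPerm N σ → σ ≡ u ++ y ∷ x₁ ++ k ∷ x₂ → suc (length u) ≡ k → k < y →
               ω k σ ≈ A k (count (_<ᵇ k) x₁) (count (_<ᵇ k) x₂)
      peak   : ∀ {σ k} u₁ u₂ y x → IsPerm N σ → σ ≡ (u₁ ++ k ∷ u₂) ++ y ∷ x → suc (length (u₁ ++ k ∷ u₂)) ≡ k →
               y < k → ω k σ ≈ B k (count (k <ᵇ_) u₂) (count (k <ᵇ_) u₁)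
      dfall  : ∀ {σ k} u y x₁ x₂ → IsPerm N σ → σ ≡ u ++ y ∷ x₁ ++ k ∷ x₂ → suc (length u) ≡ k → y < k →
               ω k σ ≈ C k (count (_<ᵇ k) x₁) (count (_<ᵇ k) x₂)
      drise  : ∀ {σ k} u₁ u₂ y x → IsPerm N σ → σ ≡ (u₁ ++ k ∷ u₂) ++ y ∷ x → suc (length (u₁ ++ k ∷ u₂)) ≡ k →
               k < y → ω k σ ≈ D k (count (k <ᵇ_) u₂) (count (k <ᵇ_) u₁)
      fixed  : ∀ {σ k} u x → IsPerm N σ → σ ≡ u ++ k ∷ x → suc (length u) ≡ k →
               count (_<ᵇ k) x ≡ count (k <ᵇ_) u → ω k σ ≈ E k (count (k <ᵇ_) u)

  module _ {N : ℕ} {ω : ℕ → List ℕ → Carrier}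
           {A B C D : ℕ → ℕ → ℕ → Carrier} {E : ℕ → ℕ → Carrier} (W : LocalWeights N ω A B C D E) where
    open LocalWeights W

    -- The lengths of the diagonal sums are the numbers of available places: h + 1 gaps among h
    -- waiting values for a valley, h + 1 open positions for a peak that lowers the height to h, and
    -- h places for a double rise or double fall at height h.
    rising levelling falling : ℕ → ℕ → Carrier
    rising    k h = diagSum R (A k) (suc h)
    levelling k h = E k h + diagSum R (D k) h + diagSum R (C k) h
    falling   k h = diagSum R (B k) (suc h)

    private
      π≥1 : ∀ {σ} → IsPerm N σ → All (1 ≤_) σ
      π≥1 π = All.map proj₁ (IsPerm.within π)

      P : ℕ → ℕ → ℕ → Carrier
      P = path rising levelling falling

      subtree : ℕ → ℕ → State → Carrier
      subtree m i s = ∑ (leaves m i s) (λ σ → ∏ (segment i m) (λ k → ω k σ))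

    module Step (m i : ℕ) (e : suc i ℕ.+ m ≡ N) (IH : ∀ {s} → Valid (suc i) (suc i) 0 s →
                subtree m (suc i) s ≈ P (suc i) m (length (proj₂ s))) where

      private
        k = suc i

      branch : State → Carrier
      branch s = ∑ (leaves m k s) (λ σ → ω k σ * ∏ (segment k m) (λ j → ω j σ))

      -- All leaves below s agree on their state after step k, so they share the factor at k, which
      -- leaves the sum.
      branch-eval : ∀ {s v} → Valid k k 0 s → (∀ {σ} → IsPerm N σ → i < length σ → state k σ ≡ s → ω k σ ≈ v) →
                    branch s ≈ v * P k m (length (proj₂ s))
      branch-eval {s} {v} V h = begin
        branch s                          ≈⟨ ∑-cong (leaves m k s) (λ {σ} σ∈ → *-congʳ (local σ∈)) ⟩
        ∑ (leaves m k s) (λ σ → v * _)    ≈⟨ ∑-*ˡ v (leaves m k s) _ ⟩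
        v * subtree m k s                 ≈⟨ *-congˡ (IH V) ⟩
        v * P k m (length (proj₂ s))      ∎
        where
        local : ∀ {σ} → σ ∈ leaves m k s → ω k σ ≈ v
        local {σ} σ∈ with π , st ← leaves-spec N m e V σ∈ =
          h π (subst (i <_) (trans e (sym (IsPerm.length≡ π))) (s≤s (ℕ.m≤m+n i m))) st

      -- The larger entries before k are the open positions and the smaller ones after it are the
      -- waiting values; by the balance both number `length L`.
      branch-fixed : ∀ {w L} → Valid i i 0 (w , L) → branch (w ++ k ∷ [] , L) ≈ E k (length L) * P k m (length L)
      branch-fixed {w} {L} V = branch-eval valid′ value
        where
        V⁺ = rows-valid {s = w , L} V (first L)
          where
          first : ∀ L → (w ++ 0 ∷ [] , L) ∈ rows (w , L)
          first []      = here refl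
          first (_ ∷ _) = here refl
        valid′ = cols-valid {i} V⁺ (∈-cols⁺ (close-col {k} {w} {[]} {L}))
        value : ∀ {σ} → IsPerm N σ → i < length σ → state k σ ≡ (w ++ k ∷ [] , L) → ω k σ ≈ E k (length L)
        value {σ} π i< st with u , y , x , refl , refl , ew , eL ← state-suc⁻ σ i< st
          with cu , cy ← ∷ʳ-injective (map (cut k) u) w ew
          with refl , _ ← cut≥1⇒≡ {k} {y} (s≤s z≤n) cy =
          ≈-trans (fixed u x π refl refl (trans #x (sym #u))) (reflexive (cong (E k) #u))
          where
          #u : count (k <ᵇ_) u ≡ length L
          #u = trans (count-above (proj₁ (All.++⁻ u (π≥1 π)))) (trans (cong (occ 0) cu) (Valid.balance V))
          #x : count (_<ᵇ k) x ≡ length L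
          #x = trans (count-below x (subst (All (_≤ i)) (sym eL) (All.map proj₂ (Valid.boundᴸ V)))) (cong length eL)

      module _ {w : List ℕ} {y : ℕ} {L : List ℕ} (V⁺ : Valid k i 1 (w ++ y ∷ [] , L)) where

        private
          assoc : ∀ {w₁ w₂} c → (w₁ ++ c ∷ w₂) ++ y ∷ [] ≡ w₁ ++ c ∷ w₂ ++ y ∷ []
          assoc {w₁} {w₂} c = ++-assoc w₁ (c ∷ w₂) (y ∷ [])

        -- The split of the state at k lifts to a split of σ itself, in which the zeros on either
        -- side of k are the entries above k.
        branch-close : ∀ {z} (F : ℕ → ℕ → Carrier) →
          (∀ {σ} u₁ u₂ y′ x → IsPerm N σ → σ ≡ (u₁ ++ k ∷ u₂) ++ y′ ∷ x → suc (length (u₁ ++ k ∷ u₂)) ≡ k →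
            cut k y′ ≡ y → ω k σ ≈ F (count (k <ᵇ_) u₂) (count (k <ᵇ_) u₁)) →
          z ∈ zeros w →
          branch (plug k (proj₁ z , proj₂ z ++ y ∷ []) , L) ≈ F (occ 0 (proj₂ z)) (occ 0 (proj₁ z)) * P k m (length L)
        branch-close {w₁ , w₂} F law z∈ with refl ← ∈-zeros⁻ {w} z∈ = branch-eval
          (cols-valid (subst (λ v → Valid k i 1 (v , L)) (assoc 0) V⁺) (∈-cols⁺ (close-col {k} {w₁} {w₂ ++ y ∷ []} {L})))
          value
          where
          value : ∀ {σ} → IsPerm N σ → i < length σ → state k σ ≡ (w₁ ++ k ∷ w₂ ++ y ∷ [] , L) →
                  ω k σ ≈ F (occ 0 w₂) (occ 0 w₁)
          value {σ} π i< st with u , y′ , x , refl , l , ew , eL ← state-suc⁻ σ i< st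
            with cu , cy ← ∷ʳ-injective (map (cut k) u) (w₁ ++ k ∷ w₂) (trans ew (sym (assoc k)))
            with u₁ , z , u₂ , refl , refl , cz , refl ← map-≡-++-∷ (cut k) u cu
            with refl , _ ← cut≥1⇒≡ {k} {z} (s≤s z≤n) cz
            with p₁ , _ ∷ p₂ ← All.++⁻ u₁ (proj₁ (All.++⁻ u (π≥1 π))) =
            ≈-trans (law u₁ u₂ y′ x π refl (cong suc l) cy)
              (reflexive (cong₂ F (count-above p₂) (count-above p₁)))

        branch-open : ∀ {z} (F : ℕ → ℕ → Carrier) →
          (∀ {σ} u y′ x₁ x₂ → IsPerm N σ → σ ≡ u ++ y′ ∷ x₁ ++ k ∷ x₂ → suc (length u) ≡ k →
            cut k y′ ≡ y → ω k σ ≈ F (count (_<ᵇ k) x₁) (count (_<ᵇ k) x₂)) →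
          z ∈ cuts L →
          branch (w ++ y ∷ [] , plug k z) ≈ F (length (proj₁ z)) (length (proj₂ z)) * P k m (suc (length L))
        branch-open {L₁ , L₂} F law z∈ with refl ← ∈-cuts⁻ {L} z∈ = ≈-trans (branch-eval
          (cols-valid V⁺ (∈-cols⁺ (open-col {k} {w ++ y ∷ []} {L₁} {L₂}))) value)
          (*-congˡ (reflexive (cong (P k m) (length-plug L₁))))
          where
          value : ∀ {σ} → IsPerm N σ → i < length σ → state k σ ≡ (w ++ y ∷ [] , L₁ ++ k ∷ L₂) →
                  ω k σ ≈ F (length L₁) (length L₂)
          value {σ} π i< st with u , y′ , x , refl , l , ew , eL ← state-suc⁻ σ i< st
            with cu , cy ← ∷ʳ-injective (map (cut k) u) w ew
            with x₁ , x₂ , refl , refl , refl ← below-≡-++-∷ k x eL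
            with p₁ , p₂ ← All.++⁻ (below k x₁) (All.map proj₂ (Valid.boundᴸ V⁺)) =
            ≈-trans (law u y′ x₁ x₂ π refl (cong suc l) cy)
              (reflexive (cong₂ F (count-below x₁ p₁) (count-below x₂ p₂)))

      ∑-cols : ∀ w L → ∑ (cols k (w , L)) branch ≈
               ∑ (zeros w) (λ z → branch (plug k z , L)) + ∑ (cuts L) (λ z → branch (w , plug k z))
      ∑-cols w L = ≈-trans (∑-++ (map (λ z → plug k z , L) (zeros w)) _ branch)
        (+-cong (reflexive (∑-map _ (zeros w) branch)) (reflexive (∑-map _ (cuts L) branch)))

      -- With σ(k) not closed at position k, the value k makes a double rise in an old open
      -- position, a fixed point in the new one, and a valley among the waiting values.
      ∑-open-row : ∀ {w L} → Valid i i 0 (w , L) → (w ++ 0 ∷ [] , L) ∈ rows (w , L) → let h = length L in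
        ∑ (cols k (w ++ 0 ∷ [] , L)) branch ≈
        (E k h + diagSum R (D k) h) * P k m h + rising k h * P k m (suc h)
      ∑-open-row {w} {L} V r∈ = begin
        ∑ (cols k (w ++ 0 ∷ [] , L)) branch
          ≈⟨ ∑-cols (w ++ 0 ∷ []) L ⟩
        ∑ (zeros (w ++ 0 ∷ [])) (λ z → branch (plug k z , L)) + ∑ (cuts L) (λ z → branch (w ++ 0 ∷ [] , plug k z))
          ≈⟨ +-cong (∑-zeros-∷ʳ0 w _) (∑-cong (cuts L) (branch-open V⁺ (A k) opens)) ⟩
        ∑ (zeros w) (λ z → branch (plug k (proj₁ z , proj₂ z ++ 0 ∷ []) , L)) + branch (w ++ k ∷ [] , L)
          + ∑ (cuts L) (λ z → A k (length (proj₁ z)) (length (proj₂ z)) * P k m (suc h))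
          ≈⟨ +-cong (+-cong (∑-cong (zeros w) (branch-close V⁺ (D k) closes)) (branch-fixed V)) (∑-*ʳ _ (cuts L) _) ⟩
        ∑ (zeros w) (λ z → D k (occ 0 (proj₂ z)) (occ 0 (proj₁ z)) * P k m h) + E k h * P k m h
          + ∑ (cuts L) (λ z → A k (length (proj₁ z)) (length (proj₂ z))) * P k m (suc h)
          ≈⟨ +-cong (+-congʳ (≈-trans (∑-*ʳ _ (zeros w) _) (*-congʳ (≈-trans (∑-zeros (D k) w)
               (reflexive (cong (diagSum R (D k)) (Valid.balance V))))))) (*-congʳ (∑-cuts (A k) L)) ⟩
        diagSum R (D k) h * P k m h + E k h * P k m h + rising k h * P k m (suc h)
          ≈⟨ +-congʳ (≈-trans (+-comm _ _) (≈-sym (distribʳ _ _ _))) ⟩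
        (E k h + diagSum R (D k) h) * P k m h + rising k h * P k m (suc h) ∎
        where
        h = length L
        V⁺ = rows-valid V r∈
        above : ∀ {σ} u y x → IsPerm N σ → σ ≡ u ++ y ∷ x → cut k y ≡ 0 → k < y
        above u y x π refl = cut≡0⇒> (All.head (proj₂ (All.++⁻ u (π≥1 π))))
        opens : ∀ {σ} u y x₁ x₂ → IsPerm N σ → σ ≡ u ++ y ∷ x₁ ++ k ∷ x₂ → suc (length u) ≡ k →
                cut k y ≡ 0 → ω k σ ≈ A k (count (_<ᵇ k) x₁) (count (_<ᵇ k) x₂)
        opens u y x₁ x₂ π σ≡ l cy = valley u y x₁ x₂ π σ≡ l (above u y _ π σ≡ cy)
        closes : ∀ {σ} u₁ u₂ y x → IsPerm N σ → σ ≡ (u₁ ++ k ∷ u₂) ++ y ∷ x → suc (length (u₁ ++ k ∷ u₂)) ≡ k →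
                 cut k y ≡ 0 → ω k σ ≈ D k (count (k <ᵇ_) u₂) (count (k <ᵇ_) u₁)
        closes u₁ u₂ y x π σ≡ l cy = drise u₁ u₂ y x π σ≡ l (above _ y x π σ≡ cy)

      -- Here σ(k) < k, so filling an open position makes k a peak and joining the waiting values
      -- makes it a double fall.
      ∑-close-row : ∀ {w y L} → Valid i i 0 (w , y ∷ L) → let h = length L in
        ∑ (cols k (w ++ y ∷ [] , L)) branch ≈ falling k h * P k m h + diagSum R (C k) (suc h) * P k m (suc h)
      ∑-close-row {w} {y} {L} V = begin
        ∑ (cols k (w ++ y ∷ [] , L)) branch
          ≈⟨ ∑-cols (w ++ y ∷ []) L ⟩
        ∑ (zeros (w ++ y ∷ [])) (λ z → branch (plug k z , L)) + ∑ (cuts L) (λ z → branch (w ++ y ∷ [] , plug k z))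
          ≈⟨ +-cong (∑-zeros-∷ʳ w _ y≥1) (∑-cong (cuts L) (branch-open V⁺ (C k) opens)) ⟩
        ∑ (zeros w) (λ z → branch (plug k (proj₁ z , proj₂ z ++ y ∷ []) , L))
          + ∑ (cuts L) (λ z → C k (length (proj₁ z)) (length (proj₂ z)) * P k m (suc h))
          ≈⟨ +-cong (∑-cong (zeros w) (branch-close V⁺ (B k) closes)) (∑-*ʳ _ (cuts L) _) ⟩
        ∑ (zeros w) (λ z → B k (occ 0 (proj₂ z)) (occ 0 (proj₁ z)) * P k m h)
          + ∑ (cuts L) (λ z → C k (length (proj₁ z)) (length (proj₂ z))) * P k m (suc h)
          ≈⟨ +-cong (≈-trans (∑-*ʳ _ (zeros w) _) (*-congʳ (≈-trans (∑-zeros (B k) w)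
               (reflexive (cong (diagSum R (B k)) (Valid.balance V)))))) (*-congʳ (∑-cuts (C k) L)) ⟩
        falling k h * P k m h + diagSum R (C k) (suc h) * P k m (suc h) ∎
        where
        h = length L
        V⁺ = rows-valid V (there (here refl))
        y≥1 = proj₁ (All.head (Valid.boundᴸ V))
        same : ∀ {y′} → cut k y′ ≡ y → y′ < k
        same {y′} cy with refl , _ ← cut≥1⇒≡ {k} {y′} y≥1 cy = s≤s (proj₂ (All.head (Valid.boundᴸ V)))
        opens : ∀ {σ} u y′ x₁ x₂ → IsPerm N σ → σ ≡ u ++ y′ ∷ x₁ ++ k ∷ x₂ → suc (length u) ≡ k →
                cut k y′ ≡ y → ω k σ ≈ C k (count (_<ᵇ k) x₁) (count (_<ᵇ k) x₂)
        opens u y′ x₁ x₂ π σ≡ l cy = dfall u y′ x₁ x₂ π σ≡ l (same cy)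
        closes : ∀ {σ} u₁ u₂ y′ x → IsPerm N σ → σ ≡ (u₁ ++ k ∷ u₂) ++ y′ ∷ x → suc (length (u₁ ++ k ∷ u₂)) ≡ k →
                 cut k y′ ≡ y → ω k σ ≈ B k (count (k <ᵇ_) u₂) (count (k <ᵇ_) u₁)
        closes u₁ u₂ y′ x π σ≡ l cy = peak u₁ u₂ y′ x π σ≡ l (same cy)

      ∑-rows : ∀ w L → Valid i i 0 (w , L) →
               ∑ (rows (w , L)) (λ s → ∑ (cols k s) branch) ≈ P i (suc m) (length L)
      ∑-rows w [] V = begin
        ∑ (cols k (w ++ 0 ∷ [] , [])) branch + 0#
          ≈⟨ ≈-trans (+-identityʳ _) (∑-open-row V (here refl)) ⟩
        (E k 0 + 0#) * P k m 0 + rising k 0 * P k m 1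
          ≈⟨ ≈-trans (+-comm _ _) (+-congˡ (*-congʳ (≈-sym (+-identityʳ _)))) ⟩
        rising k 0 * P k m 1 + (E k 0 + 0# + 0#) * P k m 0 ∎
      ∑-rows w (y ∷ L) V = begin
        ∑ (cols k (w ++ 0 ∷ [] , y ∷ L)) branch + (∑ (cols k (w ++ y ∷ [] , L)) branch + 0#)
          ≈⟨ +-cong (∑-open-row V (here refl)) (≈-trans (+-identityʳ _) (∑-close-row V)) ⟩
        (d * p₁ + r * p₂) + (f * p₀ + t * p₁)
          ≈⟨ solve 7 (λ d p₁ r p₂ f p₀ t →
               (d :* p₁ :+ r :* p₂) :+ (f :* p₀ :+ t :* p₁) := (r :* p₂ :+ (d :+ t) :* p₁) :+ f :* p₀)
               ≈-refl d p₁ r p₂ f p₀ t ⟩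
        (r * p₂ + (d + t) * p₁) + f * p₀ ∎
        where
        open import Algebra.Solver.Ring.NaturalCoefficients.Default R using (solve; _:=_; _:+_; _:*_)
        h = length L
        d = E k (suc h) + diagSum R (D k) (suc h)
        r = rising k (suc h)
        f = falling k h
        t = diagSum R (C k) (suc h)
        p₀ = P k m h
        p₁ = P k m (suc h)
        p₂ = P k m (suc (suc h))

    subtree≈path : ∀ m i s → i ℕ.+ m ≡ N → Valid i i 0 s → subtree m i s ≈ P i m (length (proj₂ s))
    subtree≈path zero    i (w , [])    e V = +-identityʳ _
    subtree≈path zero    i (w , _ ∷ _) e V = ≈-refl
    subtree≈path (suc m) i s           e V = begin
      subtree (suc m) i s                          ≈⟨ ∑-concatMap (leaves m (suc i)) (steps (suc i) s) _ ⟩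
      ∑ (steps (suc i) s) branch                   ≈⟨ ∑-concatMap (cols (suc i)) (rows s) branch ⟩
      ∑ (rows s) (λ s → ∑ (cols (suc i) s) branch) ≈⟨ ∑-rows (proj₁ s) (proj₂ s) V ⟩
      P i (suc m) (length (proj₂ s))               ∎
      where
      e′ = trans (sym (+-suc i m)) e
      IH : ∀ {s} → Valid (suc i) (suc i) 0 s → subtree m (suc i) s ≈ P (suc i) m (length (proj₂ s))
      IH {s} = subtree≈path m (suc i) s e′
      open Step m i e′ IH

    ∑-perms≈path : ∑ (perms N) (λ σ → ∏ (range N) (λ k → ω k σ)) ≈ P 0 N 0
    ∑-perms≈path = begin
      ∑ (perms N) (λ σ → ∏ (range N) (λ k → ω k σ))   ≈⟨ ∑-↭ (perms↭leaves N) ⟩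
      ∑ (leaves N 0 ([] , [])) (λ σ → ∏ (range N) (λ k → ω k σ))
        ≈⟨ reflexive (cong (λ xs → ∑ (leaves N 0 ([] , [])) (λ σ → ∏ xs (λ k → ω k σ))) (range≡segment N)) ⟩
      subtree N 0 ([] , [])                           ≈⟨ subtree≈path N 0 ([] , []) refl valid-empty ⟩
      P 0 N 0                                         ∎

-- Weights that vanish outside 𝔇₂ₙ, and the two generating functions.

module Main {c ℓ : Level} (R : CommutativeSemiring c ℓ) where
  open ≡ using (refl; sym; trans)
  open CommutativeSemiring R using (Carrier; _≈_; _+_; _*_; 0#; 1#; reflexive; zeroˡ; zeroʳ;
    +-identityʳ; +-identityˡ; +-cong; +-congˡ; +-congʳ; *-cong; *-congˡ; setoid)
    renaming (refl to ≈-refl; sym to ≈-sym; trans to ≈-trans)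
  open Sums R
  open Paths R
  open TreeSum R
  open import Relation.Binary.Reasoning.Setoid setoid

  -- One failing index already annihilates the product, so the test can be distributed over the
  -- factors.
  ∏-gated : ∀ (g : ℕ → Bool) (f : ℕ → Carrier) xs →
            (if allB g xs then ∏ xs f else 0#) ≈ ∏ xs (λ k → if g k then f k else 0#)
  ∏-gated g f []       = ≈-refl
  ∏-gated g f (x ∷ xs) with g x
  ... | false = ≈-sym (zeroˡ _)
  ... | true  with allB g xs | ∏-gated g f xs
  ...   | true  | e = *-congˡ e
  ...   | false | e = ≈-trans (≈-sym (zeroʳ _)) (*-congˡ e)

  ∑-D : ∀ n (f : List ℕ → ℕ → Carrier) → let N = 2 ℕ.* n in
        ∑ (D n) (λ σ → ∏ (range N) (f σ)) ≈
        ∑ (perms N) (λ σ → ∏ (range N) (λ k → if admits k (app σ k) then f σ k else 0#))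
  ∑-D n f = begin
    ∑ (D n) (λ σ → ∏ (range N) (f σ))
      ≈⟨ ∑-boolFilter _ (words N N) _ ⟩
    ∑ (words N N) (λ σ → if isPerm N σ ∧ isD n σ then ∏ (range N) (f σ) else 0#)
      ≈⟨ ∑-cong (words N N) (λ {σ} _ → reflexive (if-∧ (isPerm N σ))) ⟩
    ∑ (words N N) (λ σ → if isPerm N σ then (if isD n σ then ∏ (range N) (f σ) else 0#) else 0#)
      ≈⟨ ∑-boolFilter (isPerm N) (words N N) _ ⟨
    ∑ (perms N) (λ σ → if isD n σ then ∏ (range N) (f σ) else 0#)
      ≈⟨ ∑-cong (perms N) (λ {σ} _ → ≈-trans
           (reflexive (cong (λ b → if b then ∏ (range N) (f σ) else 0#) (isD≡allB n σ)))
           (∏-gated _ (f σ) (range N))) ⟩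
    ∑ (perms N) (λ σ → ∏ (range N) (λ k → if admits k (app σ k) then f σ k else 0#)) ∎
    where
    N = 2 ℕ.* n
    if-∧ : ∀ b {b′} {x : Carrier} → (if b ∧ b′ then x else 0#) ≡ (if b then (if b′ then x else 0#) else 0#)
    if-∧ true  = refl
    if-∧ false = refl

  -- The case distinction of `weightGen`, with `p` for σ⁻¹(k), `y` for σ(k) and the six values kept
  -- abstract to serve both choices of statistics.
  classify : (k p y : ℕ) (va vb vc vd ve vf : Carrier) → Carrier
  classify k p y va vb vc vd ve vf =
    if (k <ᵇ p) ∧ (k <ᵇ y) then va else
    if (p <ᵇ k) ∧ (y <ᵇ k) then vb else
    if (k <ᵇ p) ∧ (y <ᵇ k) then vc else
    if (p <ᵇ k) ∧ (k <ᵇ y) then vd else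
    if (y ≡ᵇ k) ∧ isEven k then ve else
    if (y ≡ᵇ k) ∧ not (isEven k) then vf else 1#

  -- The value 0 at the indices violating the condition defining 𝔇₂ₙ allows summing over all permutations.
  gated : (k p y : ℕ) (va vb vc vd ve vf : Carrier) → Carrier
  gated k p y va vb vc vd ve vf = if admits k y then classify k p y va vb vc vd ve vf else 0#

  -- Valleys and double rises have σ(k) > k and pass the gate only at odd k; peaks and double falls
  -- have σ(k) < k and pass it only at even k.
  atEven atOdd : ℕ → Carrier → Carrier
  atEven k v = if isEven k then v else 0#
  atOdd  k v = if isEven k then 0# else v

  module _ {k p y : ℕ} {va vb vc vd ve vf : Carrier} where

    gated-valley : k < p → k < y → gated k p y va vb vc vd ve vf ≡ atOdd k va
    gated-valley k<p k<y with isEven k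
    ... | true  rewrite <ᵇ-false {y} {suc k} k<y = refl
    ... | false rewrite <ᵇ-true {k} {suc y} (s≤s (<⇒≤ k<y)) | <ᵇ-true k<p | <ᵇ-true k<y = refl

    gated-peak : p < k → y < k → gated k p y va vb vc vd ve vf ≡ atEven k vb
    gated-peak p<k y<k with isEven k
    ... | false rewrite <ᵇ-false {k} {suc y} y<k = refl
    ... | true  rewrite <ᵇ-true {y} {suc k} (s≤s (<⇒≤ y<k)) | <ᵇ-false {k} {p} (<⇒≤ p<k) | <ᵇ-true p<k
                      | <ᵇ-true y<k = refl

    gated-dfall : k < p → y < k → gated k p y va vb vc vd ve vf ≡ atEven k vc
    gated-dfall k<p y<k with isEven k
    ... | false rewrite <ᵇ-false {k} {suc y} y<k = refl
    ... | true  rewrite <ᵇ-true {y} {suc k} (s≤s (<⇒≤ y<k)) | <ᵇ-true k<p | <ᵇ-false {k} {y} (<⇒≤ y<k)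
                      | <ᵇ-false {p} {k} (<⇒≤ k<p) | <ᵇ-true y<k = refl

    gated-drise : p < k → k < y → gated k p y va vb vc vd ve vf ≡ atOdd k vd
    gated-drise p<k k<y with isEven k
    ... | true  rewrite <ᵇ-false {y} {suc k} k<y = refl
    ... | false rewrite <ᵇ-true {k} {suc y} (s≤s (<⇒≤ k<y)) | <ᵇ-false {k} {p} (<⇒≤ p<k) | <ᵇ-true p<k
                      | <ᵇ-false {y} {k} (<⇒≤ k<y) | <ᵇ-true k<y = refl

    gated-fixed : p ≡ k → y ≡ k → gated k p y va vb vc vd ve vf ≡ (if isEven k then ve else vf)
    gated-fixed refl refl with isEven k
    ... | true  rewrite <ᵇ-true {k} {suc k} ≤-refl | <ᵇ-false {k} {k} ≤-refl | ≡ᵇ-refl k = refl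
    ... | false rewrite <ᵇ-true {k} {suc k} ≤-refl | <ᵇ-false {k} {k} ≤-refl | ≡ᵇ-refl k = refl

  diagSum-atEven : ∀ (x : ℕ → ℕ → Carrier) k h → diagSum R (λ i j → atEven k (x i j)) h ≈ atEven k (diagSum R x h)
  diagSum-atEven x k h with isEven k
  ... | true  = ≈-refl
  ... | false = ∑-0 (upTo h) (λ _ → ≈-refl)

  diagSum-atOdd : ∀ (x : ℕ → ℕ → Carrier) k h → diagSum R (λ i j → atOdd k (x i j)) h ≈ atOdd k (diagSum R x h)
  diagSum-atOdd x k h with isEven k
  ... | true  = ∑-0 (upTo h) (λ _ → ≈-refl)
  ... | false = ≈-refl

  module _ (a b c' d : ℕ → ℕ → Carrier) (e f : ℕ → Carrier) where

    private
      E : ℕ → ℕ → Carrier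
      E k h = if isEven k then e h else f h

      A B C D′ : ℕ → ℕ → ℕ → Carrier
      A  k i j = atOdd  k (a i j)
      B  k i j = atEven k (b i j)
      C  k i j = atEven k (c' i j)
      D′ k i j = atOdd  k (d i j)

    weight′ weight : ℕ → ℕ → List ℕ → Carrier
    weight′ N k σ = gated k (inv N σ k) (app σ k)
      (a (lcross' N σ k) (lnest' N σ k)) (b (ucross' N σ k) (unest' N σ k))
      (c' (lcross' N σ k) (lnest' N σ k)) (d (ucross' N σ k) (unest' N σ k)) (e (psnest N σ k)) (f (psnest N σ k))
    weight N k σ = gated k (inv N σ k) (app σ k)
      (a (ucross N σ k) (unest N σ k)) (b (lcross N σ k) (lnest N σ k))
      (c' (lcross N σ k) (lnest N σ k)) (d (ucross N σ k) (unest N σ k)) (e (psnest N σ k)) (f (psnest N σ k))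

    module _ {N : ℕ} {σ : List ℕ} {k y : ℕ} {x₁ x₂ : List ℕ} (π : IsPerm N σ) (arc : LowerArc N σ k y x₁ x₂) where
      open LowerArc arc
      open Inverse π
      open InverseStatistics π

      weight′-valley : k < y → weight′ N k σ ≈ A k (count (_<ᵇ k) x₁) (count (_<ᵇ k) x₂)
      weight′-valley k<y = reflexive (trans (gated-valley inv> (subst (k <_) (sym app≡) k<y))
        (cong₂ (A k) lcross'≡ lnest'≡))

      weight′-dfall : y < k → weight′ N k σ ≈ C k (count (_<ᵇ k) x₁) (count (_<ᵇ k) x₂)
      weight′-dfall y<k = reflexive (trans (gated-dfall inv> (subst (_< k) (sym app≡) y<k))
        (cong₂ (C k) lcross'≡ lnest'≡))

      weight-valley : k < y → weight N k (inverse N σ) ≈ A k (count (_<ᵇ k) x₁) (count (_<ᵇ k) x₂)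
      weight-valley k<y = reflexive (trans
        (gated-valley (subst (k <_) (sym (trans (inv-inverse k∈) app≡)) k<y) (subst (k <_) (sym (app-inverse k∈)) inv>))
        (cong₂ (A k) (trans (ucross-inverse k∈) lcross'≡) (trans (unest-inverse k∈) lnest'≡)))

      weight-dfall : y < k → weight N k (inverse N σ) ≈ D′ k (count (_<ᵇ k) x₁) (count (_<ᵇ k) x₂)
      weight-dfall y<k = reflexive (trans
        (gated-drise (subst (_< k) (sym (trans (inv-inverse k∈) app≡)) y<k) (subst (k <_) (sym (app-inverse k∈)) inv>))
        (cong₂ (D′ k) (trans (ucross-inverse k∈) lcross'≡) (trans (unest-inverse k∈) lnest'≡)))

    module _ {N : ℕ} {σ : List ℕ} {k y : ℕ} {u₁ u₂ : List ℕ} (π : IsPerm N σ) (arc : UpperArc N σ k y u₁ u₂) where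
      open UpperArc arc
      open Inverse π
      open InverseStatistics π

      weight′-peak : y < k → weight′ N k σ ≈ B k (count (k <ᵇ_) u₂) (count (k <ᵇ_) u₁)
      weight′-peak y<k = reflexive (trans (gated-peak inv< (subst (_< k) (sym app≡) y<k))
        (cong₂ (B k) ucross'≡ unest'≡))

      weight′-drise : k < y → weight′ N k σ ≈ D′ k (count (k <ᵇ_) u₂) (count (k <ᵇ_) u₁)
      weight′-drise k<y = reflexive (trans (gated-drise inv< (subst (k <_) (sym app≡) k<y))
        (cong₂ (D′ k) ucross'≡ unest'≡))

      weight-peak : y < k → weight N k (inverse N σ) ≈ B k (count (k <ᵇ_) u₂) (count (k <ᵇ_) u₁)
      weight-peak y<k = reflexive (trans
        (gated-peak (subst (_< k) (sym (trans (inv-inverse k∈) app≡)) y<k) (subst (_< k) (sym (app-inverse k∈)) inv<))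
        (cong₂ (B k) (trans (lcross-inverse k∈) ucross'≡) (trans (lnest-inverse k∈) unest'≡)))

      weight-drise : k < y → weight N k (inverse N σ) ≈ C k (count (k <ᵇ_) u₂) (count (k <ᵇ_) u₁)
      weight-drise k<y = reflexive (trans
        (gated-dfall (subst (k <_) (sym (trans (inv-inverse k∈) app≡)) k<y) (subst (_< k) (sym (app-inverse k∈)) inv<))
        (cong₂ (C k) (trans (lcross-inverse k∈) ucross'≡) (trans (lnest-inverse k∈) unest'≡)))

    module _ {N : ℕ} {σ : List ℕ} {k : ℕ} {u x : List ℕ} (π : IsPerm N σ) (point : FixedPoint N σ k u x) where
      open FixedPoint point
      open Inverse π

      weight′-fixed : weight′ N k σ ≈ E k (count (k <ᵇ_) u)
      weight′-fixed = reflexive (trans (gated-fixed inv≡ app≡) (cong (E k) psnest≡))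

      weight-fixed : count (_<ᵇ k) x ≡ count (k <ᵇ_) u → weight N k (inverse N σ) ≈ E k (count (k <ᵇ_) u)
      weight-fixed eq = reflexive (trans
        (gated-fixed (trans (inv-inverse k∈) app≡) (trans (app-inverse k∈) inv≡))
        (cong (E k) (trans psnest-inverse≡ eq)))

    local′ : ∀ N → LocalWeights N (weight′ N) A B C D′ E
    local′ N = record
      { valley = λ u y x₁ x₂ π σ≡ l → weight′-valley π (lowerArc u y x₁ x₂ π σ≡ l)
      ; peak   = λ u₁ u₂ y x π σ≡ l → weight′-peak π (upperArc u₁ u₂ y x π σ≡ l)
      ; dfall  = λ u y x₁ x₂ π σ≡ l → weight′-dfall π (lowerArc u y x₁ x₂ π σ≡ l)
      ; drise  = λ u₁ u₂ y x π σ≡ l → weight′-drise π (upperArc u₁ u₂ y x π σ≡ l)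
      ; fixed  = λ u x π σ≡ l _ → weight′-fixed π (fixedPoint u x π σ≡ l)
      }

    -- Inversion exchanges cycle double rises and cycle double falls, hence D′ before C.
    local : ∀ N → LocalWeights N (λ k σ → weight N k (inverse N σ)) A B D′ C E
    local N = record
      { valley = λ u y x₁ x₂ π σ≡ l → weight-valley π (lowerArc u y x₁ x₂ π σ≡ l)
      ; peak   = λ u₁ u₂ y x π σ≡ l → weight-peak π (upperArc u₁ u₂ y x π σ≡ l)
      ; dfall  = λ u y x₁ x₂ π σ≡ l → weight-dfall π (lowerArc u y x₁ x₂ π σ≡ l)
      ; drise  = λ u₁ u₂ y x π σ≡ l → weight-drise π (upperArc u₁ u₂ y x π σ≡ l)
      ; fixed  = λ u x π σ≡ l → weight-fixed π (fixedPoint u x π σ≡ l)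
      }

    private
      riseWeight levelEven levelOdd fallWeight : ℕ → Carrier
      riseWeight h = diagSum R a (suc h)
      fallWeight h = diagSum R b (suc h)
      levelEven  h = e h + diagSum R c' h
      levelOdd   h = f h + diagSum R d h

      fraction : ℕ → Carrier
      fraction = TFrac R (αQ R a b c' d e f) (δQ R e f)

    canonical-path : ∀ n → path (alternate (λ _ → 0#) riseWeight) (alternate levelEven levelOdd)
                             (alternate fallWeight (λ _ → 0#)) 0 (2 ℕ.* n) 0 ≈ fraction n
    canonical-path n = ≈-trans (reflexive (cong (λ N → path _ _ _ 0 N 0) (2*≡double n)))
      (path≈TFrac riseWeight fallWeight levelEven levelOdd _ _ α-even α-odd
        -- At height 0 the diagonal sums are empty, so the level weights there are e 0 + 0# and f 0
        -- + 0#, with product δ₁.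
        (*-cong (≈-sym (+-identityʳ _)) (≈-sym (+-identityʳ _))) (λ _ → ≈-refl) n)
      where
      α-even : ∀ h → αQ R a b c' d e f (double (suc h)) ≈ levelEven (suc h) * levelOdd (suc h)
      α-even h rewrite isEven-double h | ⌊double/2⌋ h = ≈-refl
      α-odd : ∀ h → αQ R a b c' d e f (suc (double h)) ≈ riseWeight h * fallWeight h
      α-odd h rewrite isEven-double h | ⌊double/2⌋ h = ≈-refl

    Q'≈fraction : ∀ n → Q' R a b c' d e f n ≈ fraction n
    Q'≈fraction n = begin
      Q' R a b c' d e f n                                        ≈⟨ ∑-D n _ ⟩
      ∑ (perms N) (λ σ → ∏ (range N) (λ k → weight′ N k σ))      ≈⟨ ∑-perms≈path (local′ N) ⟩
      path _ _ _ 0 N 0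
        ≈⟨ path-cong (λ k h → diagSum-atOdd a k (suc h)) level (λ k h → diagSum-atEven b k (suc h)) 0 N 0 ⟩
      path _ _ _ 0 N 0                                           ≈⟨ canonical-path n ⟩
      fraction n                                                 ∎
      where
      N = 2 ℕ.* n
      -- Parity annuls one of the two diagonal sums: c' and e remain at even steps, d and f at odd
      -- ones.
      level : ∀ k h → E k h + diagSum R (D′ k) h + diagSum R (C k) h ≈ alternate levelEven levelOdd k h
      level k h = ≈-trans (+-cong (+-congˡ (diagSum-atOdd d k h)) (diagSum-atEven c' k h)) (join k)
        where
        join : ∀ k → E k h + atOdd k (diagSum R d h) + atEven k (diagSum R c' h) ≈ alternate levelEven levelOdd k h
        join k with isEven k
        ... | true  = +-congʳ (+-identityʳ _)
        ... | false = +-identityʳ _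

    Q≈fraction : ∀ n → Q R a b c' d e f n ≈ fraction n
    Q≈fraction n = begin
      Q R a b c' d e f n                                                   ≈⟨ ∑-D n _ ⟩
      -- The gate is by now part of the weight, so the reindexing by σ⁻¹ runs over all permutations.
      ∑ (perms N) (λ σ → ∏ (range N) (λ k → weight N k σ))                 ≈⟨ ∑-↭ (perms↭inverse N) ⟨
      ∑ (map (inverse N) (perms N)) (λ σ → ∏ (range N) (λ k → weight N k σ))
        ≈⟨ reflexive (∑-map (inverse N) (perms N) _) ⟩
      ∑ (perms N) (λ σ → ∏ (range N) (λ k → weight N k (inverse N σ)))     ≈⟨ ∑-perms≈path (local N) ⟩
      path _ _ _ 0 N 0
        ≈⟨ path-cong (λ k h → diagSum-atOdd a k (suc h)) level (λ k h → diagSum-atEven b k (suc h)) 0 N 0 ⟩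
      path _ _ _ 0 N 0                                                     ≈⟨ canonical-path n ⟩
      fraction n                                                           ∎
      where
      N = 2 ℕ.* n
      -- The two diagonal sums have changed places, yet at each parity the surviving one is the same
      -- as for `Q'`.
      level : ∀ k h → E k h + diagSum R (C k) h + diagSum R (D′ k) h ≈ alternate levelEven levelOdd k h
      level k h = ≈-trans (+-cong (+-congˡ (diagSum-atEven c' k h)) (diagSum-atOdd d k h)) (join k)
        where
        join : ∀ k → E k h + atEven k (diagSum R c' h) + atOdd k (diagSum R d h) ≈ alternate levelEven levelOdd k h
        join k with isEven k
        ... | true  = +-identityʳ _
        ... | false = +-congʳ (+-identityʳ _)

theorem3p12 : ∀ {c ℓ : Level} (R : CommutativeSemiring c ℓ)
    (a b c' d : ℕ → ℕ → CommutativeSemiring.Carrier R)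
    (e f : ℕ → CommutativeSemiring.Carrier R) →
    ((n : ℕ) → CommutativeSemiring._≈_ R (Q' R a b c' d e f n)
    (TFrac R (αQ R a b c' d e f) (δQ R e f) n))
    × ((n : ℕ) → CommutativeSemiring._≈_ R (Q R a b c' d e f n) (Q' R a b c' d e f n))
theorem3p12 R a b c' d e f = Q'≈fraction a b c' d e f ,
  λ n → ≈-trans (Q≈fraction a b c' d e f n) (≈-sym (Q'≈fraction a b c' d e f n))
  where
  open Main R
  open CommutativeSemiring R using () renaming (sym to ≈-sym; trans to ≈-trans)
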